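{- The repetition threshold for binary rich words is $2+\sqrt{2}/2$; that is, $2+\sqrt2/2$ is the infimum of the set of real numbers $\alpha>1$ such that there exists an infinite binary rich word that is $\alpha$-free. Equivalently, $2+\sqrt2/2$ is the least possible critical exponent of an infinite rich word over $\{0,1\}$.
   Context: A finite word of length $n$ is rich if it has $n$ distinct nonempty palindromic factors; an infinite word is rich if all of its finite factors are rich. A finite word $u=u_1\cdots u_m$ has period $p$ if $u_i=u_{i+p}$ for $1\le i\le m-p$, and then $m/p$ is an exponent of $u$; $w$ contains an $\alpha$-power if it has a nonempty factor with an exponent $\ge \alpha$, and is $\alpha$-free otherwise. The critical exponent of $w$ is the supremum of all rational $\alpha$ such that $w$ contains an $\alpha$-power. The repetition threshold of a language $L$ is the infimum of all real $\alpha>1$ such that some infinite word of $L$ is $\alpha$-free. -}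

module Defs where

open import Data.Bool using (Bool)
open import Data.Bool.Properties renaming (_≟_ to _≟B_)
open import Data.Nat using (ℕ; _+_; _*_; _∸_; _≤_; _<_)
open import Data.List using (List; []; _∷_; map; upTo; inits; tails; concatMap; filter; deduplicate; reverse; length)
open import Data.List.Properties using (≡-dec)
open import Data.Product using (∃; ∃-syntax; _×_)
open import Relation.Binary.PropositionalEquality using (_≡_; _≢_)
open import Relation.Nullary using (Dec; yes; no; ¬_)
open import Relation.Nullary.Decidable using (_×-dec_; ¬?)

Word : Set
Word = List Bool

InfWord : Set
InfWord = ℕ → Bool

_≟W_ : (u v : Word) → Dec (u ≡ v)
_≟W_ = ≡-dec _≟B_

factors : Word → List Word
factors u = concatMap inits (tails u)

IsNonemptyPal : Word → Set
IsNonemptyPal u = (u ≢ []) × (reverse u ≡ u)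

isNonemptyPal? : (u : Word) → Dec (IsNonemptyPal u)
isNonemptyPal? u = ¬? (u ≟W []) ×-dec (reverse u ≟W u)

numPalFactors : Word → ℕ
numPalFactors u = length (deduplicate _≟W_ (filter isNonemptyPal? (factors u)))

RichFinite : Word → Set
RichFinite u = numPalFactors u ≡ length u

factorAt : InfWord → ℕ → ℕ → Word
factorAt w i n = map (λ k → w (i + k)) (upTo n)

RichInf : InfWord → Set
RichInf w = ∀ i n → RichFinite (factorAt w i n)

HasPeriodAt : InfWord → ℕ → ℕ → ℕ → Set
HasPeriodAt w i m p = ∀ k → k + p < m → w (i + k) ≡ w (i + k + p)

-- w contains an (a/b)-power: a nonempty factor of length m with a period p > 0
-- such that m/p ≥ a/b, i.e. m * b ≥ a * p.
ContainsPower : ℕ → ℕ → InfWord → Set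
ContainsPower a b w =
  ∃[ i ] ∃[ m ] ∃[ p ] (0 < m × 0 < p × HasPeriodAt w i m p × a * p ≤ m * b)

Free : ℕ → ℕ → InfWord → Set
Free a b w = ¬ ContainsPower a b w

module Submission where

-- For the existence part, take the word w whose letter changes are recorded by a Sturmian word of slope related to
-- √2, generated by ψ (0 ↦ 0, 1 ↦ 01) and the exchange of letters.  Palindromes and repetitions of w are palindromes
-- and repetitions of the Sturmian word subject to a parity condition, and ψ acts in a controlled way on both: richness
-- is inherited through the levels, and a maximal repetition lifts to one whose weighted length is governed by a
-- recurrence of Pell type with limit ratio 2 + √2/2.
--
-- Conversely, let w be rich without powers of exponent a/b < 2 + √2/2 < 11/4.  An exhaustive search on windows shows
-- that long factors of w are images f(u), then f(h(u)) or f(g(u)), and from there on that h can be peeled off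
-- indefinitely: f, g, h send letters to a marker followed by a palindrome, so richness passes to preimages, and beyond
-- the third level the search only needs cube-freeness, which passes to preimages as well.  The images of 0220 under
-- the powers of h then contain powers of exponent arbitrarily close to 2 + √2/2.  Since w is not known to avoid
-- powers, every step returns either its conclusion or a power in w.

open import Defs
open import Data.Bool using (Bool; true; false; not; _xor_; _∧_; _∨_)
open import Data.Bool.ListAction using (any; all)
open import Data.Bool.Properties using (not-involutive; xor-assoc; xor-comm; xor-identityʳ; xor-same)
  renaming (_≟_ to _≟B_)
open import Data.Empty using (⊥; ⊥-elim)
open import Data.Fin using (Fin; zero; suc)
open import Data.Fin.Patterns
open import Data.Fin.Properties using () renaming (_≟_ to _≟F_)
open import Data.List hiding (any; all; find)
open import Data.List.Membership.Propositional using (_∈_; find)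
open import Data.List.Membership.Propositional.Properties
open import Data.List.Properties
open import Data.List.Relation.Unary.All as All using (All; []; _∷_)
open import Data.List.Relation.Unary.AllPairs using ([]; _∷_)
open import Data.List.Relation.Unary.Any as Any using (Any; here; there; any?)
open import Data.List.Relation.Unary.Unique.DecPropositional.Properties using (deduplicate-!)
open import Data.List.Relation.Unary.Unique.Propositional using (Unique)
open import Data.Nat using (ℕ; zero; suc; _+_; _*_; _∸_; _/_; _^_; _≤_; _<_; z≤n; s≤s; >-nonZero)
open import Data.Nat.DivMod using (m/n*n≤m)
open import Data.Nat.Properties hiding (_≟_)
open import Data.Nat.Tactic.RingSolver using (solve-∀)
open import Data.Product using (∃-syntax; _×_; _,_; proj₁; proj₂)
open import Data.Sum using (_⊎_; inj₁; inj₂)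
open import Data.Unit using (⊤; tt)
open import Function using (_∘_)
open import Relation.Binary.Definitions using (DecidableEquality)
open import Relation.Binary.PropositionalEquality
open import Relation.Nullary using (Dec; yes; no; ¬_; does)
open import Relation.Nullary.Decidable using (_×-dec_; ¬?; map′)

-- Rich words and palindromic prefixes

-- Counting palindromes is used only at the interface. Prepending a letter adds at most one
-- palindrome, so richness means that every nonempty suffix starts with a palindrome that does not
-- occur later in it. This form, `AllNew`, makes sense over any alphabet and passes through codings.
--
-- Both halves measure words by weights on letters: the length of an iterated image is a weight of
-- the preimage, so a substitution acts on a pair of weights, whose ratio tends to √2.
--
-- The obstacle in the second half is that the searches must be finite, while a/b is arbitrary and
-- the number of levels grows with b. Replacing a/b by 11/4 makes the tests independent of a/b.
-- Whether an image contains an 11/4-power still depends on the block lengths, hence on the level;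
-- the image of a cube, however, is a cube at every level, so that a single search based on cubes
-- serves all deep levels.

private variable A : Set

Infix : List A → List A → Set
Infix q v = ∃[ l ] ∃[ r ] v ≡ l ++ q ++ r

Palindrome : List A → Set
Palindrome u = reverse u ≡ u

NewPalindrome : A → List A → Set
NewPalindrome a u = ∃[ q ] ∃[ r ] (u ≡ q ++ r × Palindrome (a ∷ q) × ¬ Infix (a ∷ q) u)

AllNew : List A → Set
AllNew []      = ⊤
AllNew (a ∷ u) = NewPalindrome a u × AllNew u

infix-∷ : ∀ {a} {q u : List A} → Infix q u → Infix q (a ∷ u)
infix-∷ {a = a} (l , r , eq) = a ∷ l , r , cong (a ∷_) eq

infix-++ˡ : ∀ (l : List A) {q u} → Infix q u → Infix q (l ++ u)
infix-++ˡ []      i = i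
infix-++ˡ (a ∷ l) i = infix-∷ (infix-++ˡ l i)

infix-++ʳ : ∀ {q u : List A} r → Infix q u → Infix q (u ++ r)
infix-++ʳ {q = q} r (l , r′ , refl) =
  l , r′ ++ r , trans (++-assoc l (q ++ r′) r) (cong (l ++_) (++-assoc q r′ r))

infix-reverse : ∀ {q u : List A} → Infix q u → Infix (reverse q) (reverse u)
infix-reverse {q = q} (l , r , refl) = reverse r , reverse l ,
  (begin
    reverse (l ++ q ++ r)                     ≡⟨ reverse-++ l (q ++ r) ⟩
    reverse (q ++ r) ++ reverse l             ≡⟨ cong (_++ reverse l) (reverse-++ q r) ⟩
    (reverse r ++ reverse q) ++ reverse l     ≡⟨ ++-assoc (reverse r) (reverse q) (reverse l) ⟩
    reverse r ++ reverse q ++ reverse l       ∎)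
  where open ≡-Reasoning

compare-prefixes : ∀ (p q : List A) {r s} → p ++ r ≡ q ++ s →
  (∃[ t ] q ≡ p ++ t) ⊎ (∃[ a ] ∃[ t ] p ≡ q ++ a ∷ t)
compare-prefixes []      q       eq = inj₁ (q , refl)
compare-prefixes (a ∷ p) []      eq = inj₂ (a , p , refl)
compare-prefixes (a ∷ p) (b ∷ q) eq with ∷-injective eq
... | refl , eq′ with compare-prefixes p q eq′
...   | inj₁ (t , refl)     = inj₁ (t , refl)
...   | inj₂ (b , t , refl) = inj₂ (b , t , refl)

-- A palindromic proper prefix of a palindrome is also a suffix of it, hence occurs away from the start.
proper-prefix-recurs : ∀ (p q : List A) {a c t} → Palindrome p → Palindrome (c ∷ q) →
  c ∷ q ≡ p ++ a ∷ t → Infix p q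
proper-prefix-recurs p q {a} {c} {t} pal-p pal-q eq = drop-head (reverse (a ∷ t)) nonempty rev
  where
  rev : c ∷ q ≡ reverse (a ∷ t) ++ p
  rev = begin
    c ∷ q                      ≡⟨ pal-q ⟨
    reverse (c ∷ q)            ≡⟨ cong reverse eq ⟩
    reverse (p ++ a ∷ t)       ≡⟨ reverse-++ p (a ∷ t) ⟩
    reverse (a ∷ t) ++ reverse p ≡⟨ cong (reverse (a ∷ t) ++_) pal-p ⟩
    reverse (a ∷ t) ++ p       ∎
    where open ≡-Reasoning
  nonempty : 0 < length (reverse (a ∷ t))
  nonempty = subst (0 <_) (sym (length-reverse (a ∷ t))) (s≤s z≤n)
  drop-head : ∀ s → 0 < length s → c ∷ q ≡ s ++ p → Infix p q
  drop-head (b ∷ s) _ e = s , [] , trans (∷-injectiveʳ e) (cong (s ++_) (sym (++-identityʳ p)))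

-- The shorter of two palindromic prefixes is also a suffix of the longer one, so it recurs; only
-- the longest palindromic prefix can be new.
new-palindrome-unique : ∀ a (u q q′ : List A) {r r′} →
  u ≡ q ++ r → Palindrome (a ∷ q) → ¬ Infix (a ∷ q) u →
  u ≡ q′ ++ r′ → Palindrome (a ∷ q′) → ¬ Infix (a ∷ q′) u → q ≡ q′
new-palindrome-unique a u q q′ {r} {r′} e pal new e′ pal′ new′
  with compare-prefixes q q′ (trans (sym e) e′)
... | inj₁ ([] , eq)        = sym (trans eq (++-identityʳ q))
... | inj₁ (b ∷ t , refl)   = ⊥-elim (new (subst (Infix (a ∷ q)) (sym e′)
        (infix-++ʳ r′ (proper-prefix-recurs (a ∷ q) q′ pal pal′ refl))))
... | inj₂ (b , t , refl)   = ⊥-elim (new′ (subst (Infix (a ∷ q′)) (sym e)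
        (infix-++ʳ r (proper-prefix-recurs (a ∷ q′) q pal′ pal refl))))

module _ {A : Set} where

  remove-∈ : ∀ {x : A} {ys} → x ∈ ys → ∃[ zs ] (length ys ≡ suc (length zs) × (∀ {y} → y ∈ ys → y ≢ x → y ∈ zs))
  remove-∈ {ys = x ∷ ys} (here refl) = ys , refl , λ where
    (here refl) ne → ⊥-elim (ne refl)
    (there i)   _  → i
  remove-∈ {ys = y ∷ ys} (there i) with remove-∈ i
  ... | zs , len , keep = y ∷ zs , cong suc len , λ where
    (here e)  _  → here e
    (there j) ne → there (keep j ne)

  unique-⊆-length : ∀ {xs ys : List A} → Unique xs → (∀ {x} → x ∈ xs → x ∈ ys) → length xs ≤ length ys
  unique-⊆-length {[]}     []         sub = z≤n
  unique-⊆-length {x ∷ xs} (x∉ ∷ uni) sub with remove-∈ (sub (here refl))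
  ... | zs , len , keep = subst (suc (length xs) ≤_) (sym len)
    (s≤s (unique-⊆-length uni λ i → keep (sub (there i)) λ { refl → All.lookup x∉ i refl }))

∈-inits⁺ : ∀ (q r : List A) → q ∈ inits (q ++ r)
∈-inits⁺ []      r = here refl
∈-inits⁺ (a ∷ q) r with ∈-inits⁺ q r
... | here refl = there (here refl)
... | there i   = there (there (∈-map⁺ (a ∷_) i))

∈-inits⁻ : ∀ (q t : List A) → q ∈ inits t → ∃[ r ] t ≡ q ++ r
∈-inits⁻ q t       (here refl)         = t , refl
∈-inits⁻ q (a ∷ t) (there (here refl)) = t , refl
∈-inits⁻ q (a ∷ t) (there (there i)) with ∈-map⁻ (a ∷_) i
... | q′ , i′ , refl with ∈-inits⁻ q′ t (there i′)
...   | r , refl = r , refl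

∈-tails⁺ : ∀ (l t : List A) → t ∈ tails (l ++ t)
∈-tails⁺ []      t = here refl
∈-tails⁺ (a ∷ l) t with l ++ t | ∈-tails⁺ l t
... | _ | here refl = there (here refl)
... | _ | there i   = there (there i)

∈-tails⁻ : ∀ (t u : List A) → t ∈ tails u → ∃[ l ] u ≡ l ++ t
∈-tails⁻ t u       (here refl)       = [] , refl
∈-tails⁻ t (a ∷ u) (there (here refl)) = a ∷ [] , refl
∈-tails⁻ t (a ∷ u) (there (there i)) with ∈-tails⁻ t u (there i)
... | l , refl = a ∷ l , refl

∈-factors⁺ : ∀ {q u : Word} → Infix q u → q ∈ factors u
∈-factors⁺ {q} (l , r , refl) = ∈-concatMap⁺ inits (Any.map (λ { refl → ∈-inits⁺ q r }) (∈-tails⁺ l (q ++ r)))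

∈-factors⁻ : ∀ {q u : Word} → q ∈ factors u → Infix q u
∈-factors⁻ {q} {u} i with find (∈-concatMap⁻ inits {xs = tails u} i)
... | t , t∈ , q∈ with ∈-tails⁻ t u t∈ | ∈-inits⁻ q t q∈
...   | l , refl | r , refl = l , r , refl

palFactors : Word → List Word
palFactors u = deduplicate _≟W_ (filter isNonemptyPal? (factors u))

∈-palFactors⁺ : ∀ {q} u → IsNonemptyPal q → Infix q u → q ∈ palFactors u
∈-palFactors⁺ u pal i = ∈-deduplicate⁺ _≟W_ (∈-filter⁺ isNonemptyPal? (∈-factors⁺ i) pal)

∈-palFactors⁻ : ∀ {q} u → q ∈ palFactors u → IsNonemptyPal q × Infix q u
∈-palFactors⁻ {q} u i with ∈-filter⁻ isNonemptyPal? {xs = factors u} (∈-deduplicate⁻ _≟W_ (filter isNonemptyPal? (factors u)) i)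
... | i′ , pal = pal , ∈-factors⁻ i′

palFactors-unique : ∀ u → Unique (palFactors u)
palFactors-unique u = deduplicate-! _≟W_ (filter isNonemptyPal? (factors u))

newPalindrome? : ∀ a (u : Word) → Dec (NewPalindrome a u)
newPalindrome? a u = map′ to from (any? test? (inits u))
  where
  Test : Word → Set
  Test q = Palindrome (a ∷ q) × ¬ ((a ∷ q) ∈ factors u)
  open import Data.List.Membership.DecPropositional _≟W_ using (_∈?_)
  test? : ∀ q → Dec (Test q)
  test? q = (reverse (a ∷ q) ≟W (a ∷ q)) ×-dec ¬? ((a ∷ q) ∈? factors u)
  to : Any Test (inits u) → NewPalindrome a u
  to t with find t
  ... | q , q∈ , pal , new with ∈-inits⁻ q u q∈
  ...   | r , eq = q , r , eq , pal , new ∘ ∈-factors⁺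
  from : NewPalindrome a u → Any Test (inits u)
  from (q , r , refl , pal , new) = Any.map (λ { refl → pal , new ∘ ∈-factors⁻ }) (∈-inits⁺ q r)

palindrome-∷-cases : ∀ {a} {u q : Word} → IsNonemptyPal q → Infix q (a ∷ u) →
  Infix q u ⊎ (∃[ q′ ] ∃[ r ] (q ≡ a ∷ q′ × u ≡ q′ ++ r))
palindrome-∷-cases                (ne , pal) (_ ∷ l , r , eq) = inj₁ (l , r , ∷-injectiveʳ eq)
palindrome-∷-cases {q = []}       (ne , pal) ([] , r , eq)    = ⊥-elim (ne refl)
palindrome-∷-cases {q = _ ∷ q}    (ne , pal) ([] , r , eq) with ∷-injective eq
... | refl , eq′ = inj₂ (q , r , refl , eq′)

numPal-no-new : ∀ a u → ¬ NewPalindrome a u → numPalFactors (a ∷ u) ≤ numPalFactors u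
numPal-no-new a u none = unique-⊆-length (palFactors-unique (a ∷ u)) sub
  where
  open import Data.List.Membership.DecPropositional _≟W_ using (_∈?_)
  sub : ∀ {x} → x ∈ palFactors (a ∷ u) → x ∈ palFactors u
  sub {x} i with ∈-palFactors⁻ (a ∷ u) i
  ... | pal , inf with x ∈? factors u
  ...   | yes j = ∈-palFactors⁺ u pal (∈-factors⁻ j)
  ...   | no ¬j with palindrome-∷-cases pal inf
  ...     | inj₁ inf′ = ∈-palFactors⁺ u pal inf′
  ...     | inj₂ (q , r , refl , eq) = ⊥-elim (none (q , r , eq , proj₂ pal , ¬j ∘ ∈-factors⁺))

numPal-new : ∀ a u → NewPalindrome a u → numPalFactors (a ∷ u) ≡ suc (numPalFactors u)
numPal-new a u (q , r , eq , pal , new) = ≤-antisym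
  (unique-⊆-length (palFactors-unique (a ∷ u)) sub)
  (unique-⊆-length (All.tabulate (λ { i refl → new (proj₂ (∈-palFactors⁻ u i)) }) ∷ palFactors-unique u) sup)
  where
  open import Data.List.Membership.DecPropositional _≟W_ using (_∈?_)
  sub : ∀ {x} → x ∈ palFactors (a ∷ u) → x ∈ (a ∷ q) ∷ palFactors u
  sub {x} i with ∈-palFactors⁻ (a ∷ u) i
  ... | palx , inf with x ∈? factors u
  ...   | yes j = there (∈-palFactors⁺ u palx (∈-factors⁻ j))
  ...   | no ¬j with palindrome-∷-cases palx inf
  ...     | inj₁ inf′ = there (∈-palFactors⁺ u palx inf′)
  ...     | inj₂ (q′ , r′ , refl , eq′) =
    here (cong (a ∷_) (sym (new-palindrome-unique a u q q′ eq pal new eq′ (proj₂ palx) (¬j ∘ ∈-factors⁺))))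
  sup : ∀ {x} → x ∈ (a ∷ q) ∷ palFactors u → x ∈ palFactors (a ∷ u)
  sup (here refl) = ∈-palFactors⁺ (a ∷ u) ((λ ()) , pal) ([] , r , cong (a ∷_) eq)
  sup (there i) with ∈-palFactors⁻ u i
  ... | palx , inf = ∈-palFactors⁺ (a ∷ u) palx (infix-∷ inf)

numPal-∷-≤ : ∀ a u → numPalFactors (a ∷ u) ≤ suc (numPalFactors u)
numPal-∷-≤ a u with newPalindrome? a u
... | yes new = ≤-reflexive (numPal-new a u new)
... | no none = m≤n⇒m≤1+n (numPal-no-new a u none)

numPal-≤-length : ∀ u → numPalFactors u ≤ length u
numPal-≤-length []      = z≤n
numPal-≤-length (a ∷ u) = ≤-trans (numPal-∷-≤ a u) (s≤s (numPal-≤-length u))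

allNew⇒rich : ∀ u → AllNew u → RichFinite u
allNew⇒rich []      _            = refl
allNew⇒rich (a ∷ u) (new , rest) = trans (numPal-new a u new) (cong suc (allNew⇒rich u rest))

rich-tail : ∀ a u → RichFinite (a ∷ u) → RichFinite u
rich-tail a u rich = ≤-antisym (numPal-≤-length u)
  (≤-pred (subst (_≤ suc (numPalFactors u)) rich (numPal-∷-≤ a u)))

-- The count gains at most one per letter, so one suffix without a new palindrome would leave a
-- deficit that no later letter makes up.
rich⇒allNew : ∀ u → RichFinite u → AllNew u
rich⇒allNew []      _    = tt
rich⇒allNew (a ∷ u) rich with newPalindrome? a u
... | yes new = new , rich⇒allNew u (rich-tail a u rich)
... | no none = ⊥-elim (1+n≰n (subst₂ _≤_ rich (rich-tail a u rich) (numPal-no-new a u none)))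

numPal-reverse-≤ : ∀ u → numPalFactors u ≤ numPalFactors (reverse u)
numPal-reverse-≤ u = unique-⊆-length (palFactors-unique u) sub
  where
  sub : ∀ {x} → x ∈ palFactors u → x ∈ palFactors (reverse u)
  sub {x} i with ∈-palFactors⁻ u i
  ... | pal , inf = ∈-palFactors⁺ (reverse u) pal (subst (λ y → Infix y (reverse u)) (proj₂ pal) (infix-reverse inf))

rich-reverse : ∀ u → RichFinite u → RichFinite (reverse u)
rich-reverse u rich = ≤-antisym (numPal-≤-length (reverse u))
  (subst (_≤ numPalFactors (reverse u)) (trans rich (sym (length-reverse u))) (numPal-reverse-≤ u))

rich-suffix : ∀ l u → RichFinite (l ++ u) → RichFinite u
rich-suffix []      u rich = rich
rich-suffix (a ∷ l) u rich = rich-suffix l u (rich-tail a (l ++ u) rich)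

-- Suffixes inherit richness letter by letter; a prefix becomes a suffix under reversal, which keeps
-- the set of palindromic factors.
rich-infix : ∀ {v u} → Infix v u → RichFinite u → RichFinite v
rich-infix {v} (l , r , refl) rich =
  subst RichFinite (reverse-involutive v)
    (rich-reverse (reverse v)
      (rich-suffix (reverse r) (reverse v)
        (subst RichFinite (reverse-++ v r)
          (rich-reverse (v ++ r) (rich-suffix l (v ++ r) rich)))))

-- Rote words obtained from a Sturmian word

ψ : Word → Word
ψ []          = []
ψ (false ∷ u) = false ∷ ψ u
ψ (true ∷ u)  = false ∷ true ∷ ψ u

-- Both blocks, 0 and 01, begin with 0 (writing 0 and 1 for `false` and `true`). The closing 0 makes
-- the map commute with reversal, so palindromes correspond to palindromes.
ψ̂ : Word → Word
ψ̂ u = ψ u ∷ʳ false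

ψ-++ : ∀ u v → ψ (u ++ v) ≡ ψ u ++ ψ v
ψ-++ []          v = refl
ψ-++ (false ∷ u) v = cong (false ∷_) (ψ-++ u v)
ψ-++ (true ∷ u)  v = cong (λ x → false ∷ true ∷ x) (ψ-++ u v)

ψ̂-++ : ∀ u v → ψ̂ (u ++ v) ≡ ψ u ++ ψ̂ v
ψ̂-++ u v = trans (cong (_∷ʳ false) (ψ-++ u v)) (++-assoc (ψ u) (ψ v) (false ∷ []))

ψ̂-head : ∀ u → ∃[ t ] ψ̂ u ≡ false ∷ t
ψ̂-head []          = _ , refl
ψ̂-head (false ∷ u) = _ , refl
ψ̂-head (true ∷ u)  = _ , refl

ψ̂-prefix : ∀ u v → ∃[ t ] ψ̂ (u ++ v) ≡ ψ̂ u ++ t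
ψ̂-prefix u v with ψ̂-head v
... | t , eq = t , trans (ψ̂-++ u v) (trans (cong (ψ u ++_) eq) (sym (++-assoc (ψ u) (false ∷ []) t)))

ψ̂-reverse : ∀ u → reverse (ψ̂ u) ≡ ψ̂ (reverse u)
ψ̂-reverse []      = refl
ψ̂-reverse (c ∷ u) = begin
  reverse (ψ̂ (c ∷ u))                  ≡⟨ cong reverse (ψ̂-++ (c ∷ []) u) ⟩
  reverse (ψ (c ∷ []) ++ ψ̂ u)          ≡⟨ reverse-++ (ψ (c ∷ [])) (ψ̂ u) ⟩
  reverse (ψ̂ u) ++ reverse (ψ (c ∷ [])) ≡⟨ cong (_++ reverse (ψ (c ∷ []))) (ψ̂-reverse u) ⟩
  (ψ (reverse u) ∷ʳ false) ++ reverse (ψ (c ∷ [])) ≡⟨ ++-assoc (ψ (reverse u)) (false ∷ []) _ ⟩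
  ψ (reverse u) ++ false ∷ reverse (ψ (c ∷ [])) ≡⟨ cong (ψ (reverse u) ++_) (block c) ⟩
  ψ (reverse u) ++ ψ̂ (c ∷ [])          ≡⟨ ψ̂-++ (reverse u) (c ∷ []) ⟨
  ψ̂ (reverse u ∷ʳ c)                   ≡⟨ cong ψ̂ (unfold-reverse c u) ⟨
  ψ̂ (reverse (c ∷ u))                  ∎
  where
  open ≡-Reasoning
  block : ∀ c → false ∷ reverse (ψ (c ∷ [])) ≡ ψ̂ (c ∷ [])
  block false = refl
  block true  = refl

ψ̂-split : ∀ u l {x} → ψ̂ u ≡ l ++ false ∷ x →
  ∃[ l′ ] ∃[ u′ ] (u ≡ l′ ++ u′ × l ≡ ψ l′ × ψ̂ u′ ≡ false ∷ x)
ψ̂-split u           []          eq = [] , u , refl , refl , eq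
ψ̂-split []          (_ ∷ [])    eq with () ← ∷-injectiveʳ eq
ψ̂-split []          (_ ∷ _ ∷ _) eq with () ← ∷-injectiveʳ eq
ψ̂-split (false ∷ u) (_ ∷ l)     eq with ∷-injective eq
... | refl , eq′ with ψ̂-split u l eq′
...   | l′ , u′ , refl , refl , e = false ∷ l′ , u′ , refl , refl , e
ψ̂-split (true ∷ u)  (_ ∷ [])    eq with () ← ∷-injectiveˡ (∷-injectiveʳ eq)
ψ̂-split (true ∷ u)  (_ ∷ _ ∷ l) eq with ∷-injective eq
... | refl , eq′ with ∷-injective eq′
...   | refl , eq″ with ψ̂-split u l eq″
...     | l′ , u′ , refl , refl , e = true ∷ l′ , u′ , refl , refl , e

ψ̂-not-true : ∀ u {x} → ψ̂ u ≢ true ∷ x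
ψ̂-not-true u eq with ψ̂-head u
... | _ , e with () ← trans (sym e) eq

ψ̂-before-true : ∀ u l {a x} → ψ̂ u ≡ l ++ a ∷ true ∷ x → a ≡ false
ψ̂-before-true []          []          eq = sym (∷-injectiveˡ eq)
ψ̂-before-true []          (_ ∷ [])    eq with () ← ∷-injectiveʳ eq
ψ̂-before-true []          (_ ∷ _ ∷ _) eq with () ← ∷-injectiveʳ eq
ψ̂-before-true (false ∷ u) []          eq = sym (∷-injectiveˡ eq)
ψ̂-before-true (false ∷ u) (_ ∷ l)     eq = ψ̂-before-true u l (∷-injectiveʳ eq)
ψ̂-before-true (true ∷ u)  []          eq = sym (∷-injectiveˡ eq)
ψ̂-before-true (true ∷ u)  (_ ∷ [])    eq = ⊥-elim (ψ̂-not-true u (∷-injectiveʳ (∷-injectiveʳ eq)))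
ψ̂-before-true (true ∷ u)  (_ ∷ _ ∷ l) eq = ψ̂-before-true u l (∷-injectiveʳ (∷-injectiveʳ eq))

ψ̂-prefix⁻ : ∀ u p {x} → ψ̂ u ≡ ψ̂ p ++ x → ∃[ r ] u ≡ p ++ r
ψ̂-prefix⁻ u           []          eq = u , refl
ψ̂-prefix⁻ []          (false ∷ p) eq with ψ̂-head p
... | t , e rewrite e with () ← ∷-injectiveʳ eq
ψ̂-prefix⁻ (false ∷ u) (false ∷ p) eq with ψ̂-prefix⁻ u p (∷-injectiveʳ eq)
... | r , refl = r , refl
ψ̂-prefix⁻ (true ∷ u)  (false ∷ p) eq with ψ̂-head p
... | t , e rewrite e with () ← ∷-injectiveˡ (∷-injectiveʳ eq)
ψ̂-prefix⁻ (false ∷ u) (true ∷ p)  eq = ⊥-elim (ψ̂-not-true u (∷-injectiveʳ eq))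
ψ̂-prefix⁻ (true ∷ u)  (true ∷ p)  eq with ψ̂-prefix⁻ u p (∷-injectiveʳ (∷-injectiveʳ eq))
... | r , refl = r , refl

-- A prefix ending with the block 01 is visibly complete, so no closing 0 is needed.
ψ-prefix⁻ : ∀ u p {x} → ψ̂ u ≡ ψ (p ∷ʳ true) ++ x → ∃[ r ] u ≡ (p ∷ʳ true) ++ r
ψ-prefix⁻ (false ∷ u) []          eq = ⊥-elim (ψ̂-not-true u (∷-injectiveʳ eq))
ψ-prefix⁻ (true ∷ u)  []          eq = u , refl
ψ-prefix⁻ []          []                  ()
ψ-prefix⁻ []          (false ∷ [])        ()
ψ-prefix⁻ []          (false ∷ false ∷ p) ()
ψ-prefix⁻ []          (false ∷ true ∷ p)  ()
ψ-prefix⁻ []          (true ∷ p)          ()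
ψ-prefix⁻ (false ∷ u) (false ∷ p) eq with ψ-prefix⁻ u p (∷-injectiveʳ eq)
... | r , refl = r , refl
ψ-prefix⁻ (true ∷ u)  (false ∷ [])        eq with () ← ∷-injectiveˡ (∷-injectiveʳ eq)
ψ-prefix⁻ (true ∷ u)  (false ∷ false ∷ p) eq with () ← ∷-injectiveˡ (∷-injectiveʳ eq)
ψ-prefix⁻ (true ∷ u)  (false ∷ true ∷ p)  eq with () ← ∷-injectiveˡ (∷-injectiveʳ eq)
ψ-prefix⁻ (false ∷ u) (true ∷ p)  eq = ⊥-elim (ψ̂-not-true u (∷-injectiveʳ eq))
ψ-prefix⁻ (true ∷ u)  (true ∷ p)  eq with ψ-prefix⁻ u p (∷-injectiveʳ (∷-injectiveʳ eq))
... | r , refl = r , refl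

-- The parity of the length if d = true, and of the number of letters false if d = false.
parity : Bool → Word → Bool
parity d []          = false
parity d (false ∷ u) = not (parity d u)
parity d (true ∷ u)  = d xor parity d u

parity-++ : ∀ d u v → parity d (u ++ v) ≡ parity d u xor parity d v
parity-++ d []          v = refl
parity-++ d (false ∷ u) v = trans (cong not (parity-++ d u v)) (sym (xor-assoc true (parity d u) (parity d v)))
parity-++ d (true ∷ u)  v = trans (cong (d xor_) (parity-++ d u v)) (sym (xor-assoc d (parity d u) (parity d v)))

not-xor : ∀ x y → not (x xor y) ≡ not x xor y
not-xor false y = refl
not-xor true  y = not-involutive y

not-xor-swap : ∀ x y → not x xor y ≡ x xor not y
not-xor-swap false y = refl
not-xor-swap true  y = sym (not-involutive y)

-- Each block contains exactly one 0, and the length of a block is odd exactly for the letter 0: ψ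
-- exchanges the two parities.
parity-ψ : ∀ d u → parity d (ψ u) ≡ parity (not d) u
parity-ψ d []          = refl
parity-ψ d (false ∷ u) = cong not (parity-ψ d u)
parity-ψ d (true ∷ u)  = trans (not-xor d (parity d (ψ u))) (cong (not d xor_) (parity-ψ d u))

parity-∷ʳ : ∀ d u → parity d (u ∷ʳ false) ≡ not (parity d u)
parity-∷ʳ d u = trans (parity-++ d u (false ∷ [])) (xor-comm (parity d u) true)

parity-ψ̂ : ∀ d u → parity (not d) u ≡ not d → parity d (ψ̂ u) ≡ d
parity-ψ̂ d u eq = trans (parity-∷ʳ d (ψ u)) (trans (cong not (trans (parity-ψ d u) eq)) (not-involutive d))

-- Rote false v makes integrate b v start with a palindrome occurring only once; Rote true is the condition that
-- ψ̂ exchanges with it.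
Rote : Bool → Word → Set
Rote d v = ∃[ q ] ∃[ r ] (v ≡ q ++ r × Palindrome q × parity d q ≡ d ×
  (∀ l r′ → v ≡ l ++ q ++ r′ → parity d l ≡ false → l ≡ []))

AllRote : Bool → Word → Set
AllRote d []      = ⊤
AllRote d (a ∷ u) = Rote d (a ∷ u) × AllRote d u

rote-ψ̂ : ∀ d u → Rote (not d) u → Rote d (ψ̂ u)
rote-ψ̂ d u (p , r , refl , pal , par , new) with ψ̂-prefix p r
... | t , eq = ψ̂ p , t , eq , trans (ψ̂-reverse p) (cong ψ̂ pal) , parity-ψ̂ d p par , new′
  where
  new′ : ∀ l r′ → ψ̂ (p ++ r) ≡ l ++ ψ̂ p ++ r′ → parity d l ≡ false → l ≡ []
  new′ l r′ e pl with ψ̂-head p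
  ... | t , e′ with ψ̂-split (p ++ r) l (trans e (cong (λ x → l ++ x ++ r′) e′))
  ...   | l′ , u′ , e₁ , refl , e₂ with ψ̂-prefix⁻ u′ p (trans e₂ (cong (_++ r′) (sym e′)))
  ...     | r″ , refl with new l′ r″ e₁ (trans (sym (parity-ψ d l′)) pl)
  ...       | refl = refl

-- This is the suffix that starts inside a block 01. The palindrome 1p upstairs gives ψ̂(1p) = 0q0,
-- and q is taken. A later occurrence of q begins with 1, so it is preceded by 0 and comes from an
-- occurrence of 1p.
rote-true∷ψ̂ : ∀ d u → Rote (not d) (true ∷ u) → Rote d (true ∷ ψ̂ u)
rote-true∷ψ̂ true  u ([] , r , eq , pal , par , new) with () ← new (true ∷ []) u refl refl
rote-true∷ψ̂ d u (true ∷ p , r , eq , pal , par , new) with ∷-injectiveʳ eq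
... | refl = q , ψ̂ r , cong (true ∷_) (ψ̂-++ p r) , pal-q , par-q , new′
  where
  q = true ∷ ψ p
  pal-q : Palindrome q
  pal-q = ∷ʳ-injectiveˡ (reverse q) q (∷-injectiveʳ (begin
    false ∷ reverse q ∷ʳ false    ≡⟨ cong (_∷ʳ false) (reverse-++ q (false ∷ [])) ⟨
    reverse (q ∷ʳ false) ∷ʳ false ≡⟨ unfold-reverse false (q ∷ʳ false) ⟨
    reverse (ψ̂ (true ∷ p))        ≡⟨ ψ̂-reverse (true ∷ p) ⟩
    ψ̂ (reverse (true ∷ p))        ≡⟨ cong ψ̂ pal ⟩
    false ∷ q ∷ʳ false            ∎))
    where open ≡-Reasoning
  par-q : parity d q ≡ d
  par-q = begin
    parity d q                  ≡⟨ not-involutive _ ⟨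
    not (not (parity d q))      ≡⟨ parity-∷ʳ d (false ∷ q) ⟨
    parity d (ψ̂ (true ∷ p))     ≡⟨ parity-ψ̂ d (true ∷ p) par ⟩
    d                           ∎
    where open ≡-Reasoning
  new′ : ∀ l r′ → true ∷ ψ̂ (p ++ r) ≡ l ++ q ++ r′ → parity d l ≡ false → l ≡ []
  new′ l r′ e pl with initLast l
  ... | [] = refl
  ... | l₁ ∷ʳ′ a with ψ̂-before-true (true ∷ p ++ r) (false ∷ l₁)
                      (cong (false ∷_) (trans e (++-assoc l₁ (a ∷ []) (q ++ r′))))
  ...   | refl with ψ̂-split (true ∷ p ++ r) (false ∷ l₁)
                      (cong (false ∷_) (trans e (++-assoc l₁ (false ∷ []) (q ++ r′))))
  ...     | l′ , u′ , e₁ , e₂ , e₃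
    -- The palindrome 1p also ends with 1, so it equals `reverse p ∷ʳ true` and its image ends with
    -- 01.
    with ψ-prefix⁻ u′ (reverse p) (trans e₃ (cong (λ x → ψ x ++ r′) (trans (sym pal) (unfold-reverse true p))))
  ...       | r″ , refl
    with new l′ r″ (trans e₁ (cong (λ x → l′ ++ x ++ r″) (trans (sym (unfold-reverse true p)) pal)))
           (trans (sym (parity-ψ d l′)) (trans (cong (parity d) (sym e₂)) (trans (sym (parity-∷ʳ d l₁)) pl)))
  ...         | refl with () ← e₂

allRote-ψ̂ : ∀ d u → AllRote (not d) u → AllRote d (ψ̂ u)
allRote-ψ̂ true  []          _ = rote-ψ̂ true [] ([] , [] , refl , refl , refl , λ { [] _ _ _ → refl }) , tt
-- The empty palindrome serves: its occurrence after the letter 0 is at odd parity.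
allRote-ψ̂ false []          _ = ([] , _ , refl , refl , refl ,
  λ { [] _ _ _ → refl ; (false ∷ []) _ _ () ; (true ∷ []) _ () _ ; (_ ∷ _ ∷ _) _ () _ }) , tt
allRote-ψ̂ d     (false ∷ u) (x , xs) = rote-ψ̂ d (false ∷ u) x , allRote-ψ̂ d u xs
allRote-ψ̂ d     (true ∷ u)  (x , xs) = rote-ψ̂ d (true ∷ u) x , rote-true∷ψ̂ d u x , allRote-ψ̂ d u xs

E : Word → Word
E = map not

E-involutive : ∀ u → E (E u) ≡ u
E-involutive []      = refl
E-involutive (c ∷ u) = cong₂ _∷_ (not-involutive c) (E-involutive u)

parity-E : ∀ u → parity true (E u) ≡ parity true u
parity-E []          = refl
parity-E (false ∷ u) = cong not (parity-E u)
parity-E (true ∷ u)  = cong not (parity-E u)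

E-swap : ∀ {u v} → E u ≡ v → u ≡ E v
E-swap {u} eq = trans (sym (E-involutive u)) (cong E eq)

E-++₃ : ∀ {u} l q r → E u ≡ l ++ q ++ r → u ≡ E l ++ E q ++ E r
E-++₃ l q r eq = trans (E-swap eq) (trans (map-++ not l (q ++ r)) (cong (E l ++_) (map-++ not q r)))

-- Exchanging the letters keeps lengths but not the number of letters 0, hence only `Rote true`.
rote-E : ∀ u → Rote true u → Rote true (E u)
rote-E u (q , r , eq , pal , par , new) =
  E q , E r , trans (cong E eq) (map-++ not q r) , trans (sym (reverse-map not q)) (cong E pal) ,
  trans (parity-E q) par , new′
  where
  new′ : ∀ l r′ → E u ≡ l ++ E q ++ r′ → parity true l ≡ false → l ≡ []
  new′ l r′ e pl = E-swap (new (E l) (E r′)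
    (trans (E-++₃ l (E q) r′ e) (cong (λ x → E l ++ x ++ E r′) (E-involutive q)))
    (trans (parity-E l) pl))

allRote-E : ∀ u → AllRote true u → AllRote true (E u)
allRote-E []      _        = tt
allRote-E (a ∷ u) (x , xs) = rote-E (a ∷ u) x , allRote-E u xs

-- The letters false of v mark the changes of letter.
integrate : Bool → Word → Word
integrate b []          = b ∷ []
integrate b (false ∷ v) = b ∷ integrate (not b) v
integrate b (true ∷ v)  = b ∷ integrate b v

integrate-prefix : ∀ b u v → ∃[ t ] integrate b (u ++ v) ≡ integrate b u ++ t
integrate-prefix b []          []          = [] , refl
integrate-prefix b []          (false ∷ v) = _ , refl
integrate-prefix b []          (true ∷ v)  = _ , refl
integrate-prefix b (false ∷ u) v with integrate-prefix (not b) u v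
... | t , eq = t , cong (b ∷_) eq
integrate-prefix b (true ∷ u)  v with integrate-prefix b u v
... | t , eq = t , cong (b ∷_) eq

integrate-∷ʳ : ∀ b u c → integrate b (u ∷ʳ c) ≡ integrate b u ∷ʳ (b xor parity false (u ∷ʳ c))
integrate-∷ʳ false []          false = refl
integrate-∷ʳ false []          true  = refl
integrate-∷ʳ true  []          false = refl
integrate-∷ʳ true  []          true  = refl
integrate-∷ʳ b     (false ∷ u) c = cong (b ∷_) (trans (integrate-∷ʳ (not b) u c) (cong (λ x → integrate (not b) u ∷ʳ x) (not-xor-swap b _)))
integrate-∷ʳ b     (true ∷ u)  c = cong (b ∷_) (integrate-∷ʳ b u c)

parity-reverse : ∀ d u → parity d (reverse u) ≡ parity d u
parity-reverse d []      = refl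
parity-reverse d (c ∷ u) = begin
  parity d (reverse (c ∷ u))          ≡⟨ cong (parity d) (unfold-reverse c u) ⟩
  parity d (reverse u ∷ʳ c)           ≡⟨ parity-++ d (reverse u) (c ∷ []) ⟩
  parity d (reverse u) xor parity d (c ∷ []) ≡⟨ cong (_xor parity d (c ∷ [])) (parity-reverse d u) ⟩
  parity d u xor parity d (c ∷ [])    ≡⟨ xor-comm (parity d u) _ ⟩
  parity d (c ∷ []) xor parity d u    ≡⟨ parity-++ d (c ∷ []) u ⟨
  parity d (c ∷ u)                    ∎
  where open ≡-Reasoning

integrate-reverse : ∀ b u → reverse (integrate b u) ≡ integrate (b xor parity false u) (reverse u)
integrate-reverse false [] = refl
integrate-reverse true  [] = refl
integrate-reverse b (c ∷ u) = begin
  reverse (integrate b (c ∷ u))      ≡⟨ step c ⟩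
  integrate (b xor parity false (c ∷ u)) (reverse u) ∷ʳ b
    ≡⟨ cong (λ x → integrate (b xor parity false (c ∷ u)) (reverse u) ∷ʳ x) (sym last-letter) ⟩
  integrate (b xor parity false (c ∷ u)) (reverse u) ∷ʳ ((b xor parity false (c ∷ u)) xor parity false (reverse u ∷ʳ c))
    ≡⟨ integrate-∷ʳ _ (reverse u) c ⟨
  integrate (b xor parity false (c ∷ u)) (reverse u ∷ʳ c) ≡⟨ cong (integrate _) (unfold-reverse c u) ⟨
  integrate (b xor parity false (c ∷ u)) (reverse (c ∷ u)) ∎
  where
  open ≡-Reasoning
  last-letter : (b xor parity false (c ∷ u)) xor parity false (reverse u ∷ʳ c) ≡ b
  last-letter = begin
    (b xor parity false (c ∷ u)) xor parity false (reverse u ∷ʳ c)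
      ≡⟨ cong ((b xor parity false (c ∷ u)) xor_) (trans (cong (parity false) (sym (unfold-reverse c u))) (parity-reverse false (c ∷ u))) ⟩
    (b xor parity false (c ∷ u)) xor parity false (c ∷ u) ≡⟨ xor-assoc b _ _ ⟩
    b xor (parity false (c ∷ u) xor parity false (c ∷ u)) ≡⟨ cong (b xor_) (xor-same (parity false (c ∷ u))) ⟩
    b xor false ≡⟨ xor-identityʳ b ⟩
    b ∎
  step : ∀ c → reverse (integrate b (c ∷ u)) ≡ integrate (b xor parity false (c ∷ u)) (reverse u) ∷ʳ b
  step false = trans (unfold-reverse b (integrate (not b) u)) (cong (_∷ʳ b)
    (trans (integrate-reverse (not b) u) (cong (λ x → integrate x (reverse u)) (not-xor-swap b (parity false u)))))
  step true = trans (unfold-reverse b (integrate b u)) (cong (_∷ʳ b) (integrate-reverse b u))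

integrate-head : ∀ b u → ∃[ t ] integrate b u ≡ b ∷ t
integrate-head b []          = _ , refl
integrate-head b (false ∷ u) = _ , refl
integrate-head b (true ∷ u)  = _ , refl

integrate-prefix⁻ : ∀ b b′ u q {x} → integrate b u ≡ integrate b′ q ++ x → b ≡ b′ × (∃[ r ] u ≡ q ++ r)
integrate-prefix⁻ b b′ u [] eq with integrate-head b u
... | t , e with ∷-injectiveˡ (trans (sym e) eq)
...   | refl = refl , u , refl
integrate-prefix⁻ b b′ []          (false ∷ q) eq with integrate-head (not b′) q
... | t , e rewrite e with () ← ∷-injectiveʳ eq
integrate-prefix⁻ b b′ []          (true ∷ q)  eq with integrate-head b′ q
... | t , e rewrite e with () ← ∷-injectiveʳ eq
integrate-prefix⁻ b b′ (false ∷ u) (false ∷ q) eq with ∷-injective eq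
... | refl , eq′ with integrate-prefix⁻ (not b) (not b) u q eq′
...   | _ , r , refl = refl , r , refl
integrate-prefix⁻ b b′ (true ∷ u)  (true ∷ q)  eq with ∷-injective eq
... | refl , eq′ with integrate-prefix⁻ b b u q eq′
...   | _ , r , refl = refl , r , refl
integrate-prefix⁻ b b′ (false ∷ u) (true ∷ q)  eq with ∷-injective eq
... | refl , eq′ with proj₁ (integrate-prefix⁻ (not b) b u q eq′)
integrate-prefix⁻ false _ (false ∷ u) (true ∷ q) eq | refl , eq′ | ()
integrate-prefix⁻ true  _ (false ∷ u) (true ∷ q) eq | refl , eq′ | ()
integrate-prefix⁻ b b′ (true ∷ u)  (false ∷ q) eq with ∷-injective eq
... | refl , eq′ with proj₁ (integrate-prefix⁻ b (not b) u q eq′)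
integrate-prefix⁻ false _ (true ∷ u) (false ∷ q) eq | refl , eq′ | ()
integrate-prefix⁻ true  _ (true ∷ u) (false ∷ q) eq | refl , eq′ | ()

integrate-infix⁻ : ∀ b b′ v l q {r} → integrate b v ≡ l ++ integrate b′ q ++ r →
  ∃[ l′ ] ∃[ r′ ] (v ≡ l′ ++ q ++ r′ × b′ ≡ b xor parity false l′ × length l′ ≡ length l)
integrate-infix⁻ b b′ v [] q eq with integrate-prefix⁻ b b′ v q eq
... | refl , r , refl = [] , r , refl , sym (xor-identityʳ b) , refl
integrate-infix⁻ b b′ [] (_ ∷ l) q eq with integrate-head b′ q
... | t , e rewrite e with () ← ++-conicalʳ l _ (sym (∷-injectiveʳ eq))
integrate-infix⁻ b b′ (false ∷ v) (_ ∷ l) q eq with integrate-infix⁻ (not b) b′ v l q (∷-injectiveʳ eq)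
... | l′ , r′ , refl , e , len = false ∷ l′ , r′ , refl , trans e (not-xor-swap b _) , cong suc len
integrate-infix⁻ b b′ (true ∷ v)  (_ ∷ l) q eq with integrate-infix⁻ b b′ v l q (∷-injectiveʳ eq)
... | l′ , r′ , refl , e , len = true ∷ l′ , r′ , refl , e , cong suc len

-- A palindrome q with evenly many changes integrates to a palindrome, and `integrate b q` recurs
-- only where q recurs after evenly many changes, because the first letter must again be b.
allNew-integrate : ∀ b v → AllRote false v → AllNew (integrate b v)
allNew-integrate b [] _ = ([] , [] , refl , refl , λ { (l , r , eq) → impossible l eq }) , tt
  where
  impossible : ∀ l {r} → [] ≡ l ++ b ∷ r → ⊥
  impossible [] ()
  impossible (_ ∷ _) ()
allNew-integrate b (c ∷ v) ((q , r , eq , pal , par , new) , rest) = go c eq new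
  where
  go : ∀ c → c ∷ v ≡ q ++ r → (∀ l r′ → c ∷ v ≡ l ++ q ++ r′ → parity false l ≡ false → l ≡ []) →
    AllNew (integrate b (c ∷ v))
  newPal : ∀ c b₁ → integrate b (c ∷ v) ≡ b ∷ integrate b₁ v → b₁ xor b ≡ parity false (c ∷ []) → 
    c ∷ v ≡ q ++ r → (∀ l r′ → c ∷ v ≡ l ++ q ++ r′ → parity false l ≡ false → l ≡ []) →
    NewPalindrome b (integrate b₁ v)
  newPal c b₁ ie pc eq new with integrate-prefix b q r | integrate-head b q
  ... | t , e | t′ , e′ = t′ , t ,
    ∷-injectiveʳ (trans (sym ie) (trans (cong (integrate b) eq) (trans e (cong (_++ t) e′)))) ,
    subst Palindrome e′ (trans (integrate-reverse b q) (cong₂ integrate (trans (cong (b xor_) par) (xor-identityʳ b)) pal)) ,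
    λ (l , r″ , o) → contra l (trans o (cong (λ x → l ++ x ++ r″) (sym e′)))
    where
    contra : ∀ l {r″} → integrate b₁ v ≡ l ++ integrate b q ++ r″ → ⊥
    contra l o with integrate-infix⁻ b₁ b v l q o
    ... | l′ , r′ , ev , eb , _ with new (c ∷ l′) r′ (cong (c ∷_) ev)
          (trans (parity-++ false (c ∷ []) l′) (trans (cong (_xor parity false l′) (sym pc)) (cancel b₁ b _ eb)))
      where
      cancel : ∀ x y z → y ≡ x xor z → (x xor y) xor z ≡ false
      cancel false _ z refl = xor-same z
      cancel true  _ z refl = trans (cong (_xor z) (not-involutive z)) (xor-same z)
    ... | ()
  go false eq new = newPal false (not b) refl (nb b) eq new , allNew-integrate (not b) v rest
    where
    nb : ∀ b → not b xor b ≡ true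
    nb false = refl
    nb true  = refl
  go true  eq new = newPal true b refl (xor-same b) eq new , allNew-integrate b v rest

-- Repetitions in the Rote word

weight : ℕ → ℕ → Word → ℕ
weight x y []          = 0
weight x y (false ∷ u) = x + weight x y u
weight x y (true ∷ u)  = y + weight x y u

weight-++ : ∀ x y u v → weight x y (u ++ v) ≡ weight x y u + weight x y v
weight-++ x y []          v = refl
weight-++ x y (false ∷ u) v = trans (cong (x +_) (weight-++ x y u v)) (sym (+-assoc x _ _))
weight-++ x y (true ∷ u)  v = trans (cong (y +_) (weight-++ x y u v)) (sym (+-assoc y _ _))

weight-ψ : ∀ x y u → weight x y (ψ u) ≡ weight x (x + y) u
weight-ψ x y []          = refl
weight-ψ x y (false ∷ u) = cong (x +_) (weight-ψ x y u)
weight-ψ x y (true ∷ u)  = trans (cong (λ z → x + (y + z)) (weight-ψ x y u)) (sym (+-assoc x y _))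

weight-ψ̂ : ∀ x y u → weight x y (ψ̂ u) ≡ weight x (x + y) u + x
weight-ψ̂ x y u = trans (weight-++ x y (ψ u) (false ∷ [])) (cong₂ _+_ (weight-ψ x y u) (+-identityʳ x))

weight-E : ∀ x y u → weight x y (E u) ≡ weight y x u
weight-E x y []          = refl
weight-E x y (false ∷ u) = cong (y +_) (weight-E x y u)
weight-E x y (true ∷ u)  = cong (x +_) (weight-E x y u)

weight-length : ∀ u → weight 1 1 u ≡ length u
weight-length []          = refl
weight-length (false ∷ u) = cong suc (weight-length u)
weight-length (true ∷ u)  = cong suc (weight-length u)

LeftMaximal : Word → Word → Set
LeftMaximal l v = ∀ {l′ v′ a} → l ≡ l′ ∷ʳ a → v ≡ v′ ∷ʳ a → ⊥

-- Where u and v part, the images read 00 and 01. Beyond the image of the common prefix z they share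
-- at most the 0 that opens the next block, and this is the closing letter of `ψ̂ z`.
common-prefix-ψ̂ : ∀ u v y {r r′} → ψ̂ u ≡ y ++ r → ψ̂ v ≡ y ++ r′ →
  ∃[ z ] ∃[ s ] ∃[ s′ ] ∃[ t ] (u ≡ z ++ s × v ≡ z ++ s′ × ψ̂ z ≡ y ++ t)
common-prefix-ψ̂ []          v           y  {r} e e′ = [] , [] , v , r , refl , refl , e
common-prefix-ψ̂ u           []          y  {r′ = r′} e e′ = [] , u , [] , r′ , refl , refl , e′
common-prefix-ψ̂ u           v           [] e e′ = [] , u , v , _ , refl , refl , refl
common-prefix-ψ̂ (false ∷ u) (false ∷ v) (_ ∷ y) e e′ with ∷-injective e
... | refl , e₁ with common-prefix-ψ̂ u v y e₁ (∷-injectiveʳ e′)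
...   | z , s , s′ , t , refl , refl , e₂ = false ∷ z , s , s′ , t , refl , refl , cong (false ∷_) e₂
common-prefix-ψ̂ (c ∷ u) (d ∷ v) (a ∷ []) e e′ with ψ̂-head (c ∷ u)
... | t , h with ∷-injectiveˡ (trans (sym h) e)
...   | refl = [] , c ∷ u , d ∷ v , [] , refl , refl , refl
common-prefix-ψ̂ (false ∷ u) (true ∷ v)  (_ ∷ _ ∷ y) e e′ with ∷-injectiveˡ (∷-injectiveʳ e′)
... | refl = ⊥-elim (ψ̂-not-true u (∷-injectiveʳ e))
common-prefix-ψ̂ (true ∷ u)  (false ∷ v) (_ ∷ _ ∷ y) e e′ with ∷-injectiveˡ (∷-injectiveʳ e)
... | refl = ⊥-elim (ψ̂-not-true v (∷-injectiveʳ e′))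
common-prefix-ψ̂ (true ∷ u)  (true ∷ v)  (_ ∷ _ ∷ y) e e′ with ∷-injective e
... | refl , e₁ with ∷-injective e₁
...   | refl , e₂ with common-prefix-ψ̂ u v y e₂ (∷-injectiveʳ (∷-injectiveʳ e′))
...     | z , s , s′ , t , refl , refl , e₃ =
  true ∷ z , s , s′ , t , refl , refl , cong (λ w → false ∷ true ∷ w) e₃

-- The block of a letter ends with that letter.
leftMaximal-ψ : ∀ {l v} → LeftMaximal (ψ l) (ψ v) → LeftMaximal l v
leftMaximal-ψ lm {l′} {v′} {false} refl refl = lm (ψ-++ l′ (false ∷ [])) (ψ-++ v′ (false ∷ []))
leftMaximal-ψ lm {l′} {v′} {true}  refl refl = lm (last-true l′) (last-true v′)
  where
  last-true : ∀ u → ψ (u ∷ʳ true) ≡ (ψ u ∷ʳ false) ∷ʳ true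
  last-true u = trans (ψ-++ u (true ∷ [])) (sym (++-assoc (ψ u) (false ∷ []) (true ∷ [])))

snoc-view : ∀ (a : Bool) v → ∃[ v′ ] ∃[ a′ ] a ∷ v ≡ v′ ∷ʳ a′
snoc-view a []      = [] , a , refl
snoc-view a (b ∷ v) with snoc-view b v
... | v′ , a′ , eq = a ∷ v′ , a′ , cong (a ∷_) eq

-- The ratio c/b bounds overlap divided by period, that is, the exponent minus 1; it is applied with
-- `c = a ∸ b`.
module Bound (b c : ℕ) where

  -- In l ++ v ++ r, the word v followed by the common prefix y of v ++ r and r is a repetition of period
  -- length v; the truncation x + y ∸ 1 is moved to the other side.
  Bounded : Bool → ℕ → ℕ → Word → Set
  Bounded d x y u = ∀ l v r p s s′ → u ≡ l ++ v ++ r → LeftMaximal l v → v ≢ [] → parity d v ≡ false →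
    v ++ r ≡ p ++ s → r ≡ p ++ s′ → b * (weight x y p + (x + y)) < c * weight x y v + b

  BoundedPeriod : Bool → ℕ → ℕ → Word → Set
  BoundedPeriod d x y u = ∀ l v r → u ≡ l ++ v ++ r → v ≢ [] → parity d v ≡ false →
    b * (x + y) < c * weight x y v + b

  -- If the overlap began with 1, both copies would be preceded by 0, against left maximality. So a
  -- nonempty overlap starts at a block boundary, and the repetition comes from one upstairs with
  -- overlap z, where `ψ̂ z` covers the given overlap. The closing 0 weighs x and turns the added
  -- term x + y into x + (x + y), the same term for the new weights.
  bounded-ψ̂ : ∀ d x y u → BoundedPeriod d x y (ψ̂ u) → Bounded (not d) x (x + y) u → Bounded d x y (ψ̂ u)
  bounded-ψ̂ d x y u base bnd l v r [] s s′ eq lm ne par e e′ = base l v r eq ne par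
  bounded-ψ̂ d x y u base bnd l [] r (_ ∷ p) s s′ eq lm ne par e e′ = ⊥-elim (ne refl)
  bounded-ψ̂ d x y u base bnd l (_ ∷ v) r (true ∷ p) s s′ eq lm ne par e refl with ∷-injective e
  ... | refl , e₁ with snoc-view true v
  ...   | v₁ , a′ , ev = ⊥-elim (no-start (initLast l))
    where
    open ≡-Reasoning
    both-false : ∀ {l₁ a} → l ≡ l₁ ∷ʳ a → a ≡ false → a′ ≡ false → ⊥
    both-false el refl refl = lm el ev
    no-start : InitLast l → ⊥
    no-start []         = ψ̂-not-true u eq
    no-start (l₁ ∷ʳ′ a) = both-false refl
      (ψ̂-before-true u l₁ (trans eq (++-assoc l₁ (a ∷ []) _)))
      (ψ̂-before-true u (l ++ v₁) (begin
          ψ̂ u                                   ≡⟨ eq ⟩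
          l ++ (true ∷ v) ++ true ∷ p ++ s′     ≡⟨ cong (λ z → l ++ z ++ true ∷ p ++ s′) ev ⟩
          l ++ (v₁ ∷ʳ a′) ++ true ∷ p ++ s′     ≡⟨ cong (l ++_) (++-assoc v₁ (a′ ∷ []) _) ⟩
          l ++ v₁ ++ a′ ∷ true ∷ p ++ s′        ≡⟨ ++-assoc l v₁ _ ⟨
          (l ++ v₁) ++ a′ ∷ true ∷ p ++ s′      ∎))
  bounded-ψ̂ d x y u base bnd l (_ ∷ v) r (false ∷ p) s s′ eq lm ne par e refl with ∷-injective e
  ... | refl , e₁ with ψ̂-split u l eq
  ...   | l′ , u′ , refl , refl , eq₁ with ψ̂-split u′ (false ∷ v) eq₁
  ...     | v′ , r′ , refl , ev , eq₂ with common-prefix-ψ̂ (v′ ++ r′) r′ (false ∷ p) (trans eq₁ e) eq₂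
  ...       | z , t , t′ , t″ , e₃ , e₄ , e₅ = begin-strict
    b * (weight x y (false ∷ p) + (x + y)) ≤⟨ *-monoʳ-≤ b (≤-trans (+-monoˡ-≤ (x + y) shorter) (≤-reflexive (+-assoc (weight x (x + y) z) x (x + y)))) ⟩
    b * (weight x (x + y) z + (x + (x + y))) <⟨ bnd l′ v′ r′ z t t′ refl
        (leftMaximal-ψ (λ {_} {_} {_} p q → lm p (trans ev q))) (λ { refl → ne ev })
        (trans (sym (parity-ψ d v′)) (trans (cong (parity d) (sym ev)) par)) e₃ e₄ ⟩
    c * weight x (x + y) v′ + b          ≡⟨ cong (λ w → c * w + b) (weight-ψ x y v′) ⟨
    c * weight x y (ψ v′) + b            ≡⟨ cong (λ w → c * weight x y w + b) ev ⟨
    c * weight x y (false ∷ v) + b       ∎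
    where
    open ≤-Reasoning
    shorter : weight x y (false ∷ p) ≤ weight x (x + y) z + x
    shorter = begin
      weight x y (false ∷ p)                    ≤⟨ m≤m+n _ _ ⟩
      weight x y (false ∷ p) + weight x y t″    ≡⟨ weight-++ x y (false ∷ p) t″ ⟨
      weight x y (false ∷ p ++ t″)              ≡⟨ cong (weight x y) e₅ ⟨
      weight x y (ψ̂ z)                          ≡⟨ weight-ψ̂ x y z ⟩
      weight x (x + y) z + x                    ∎

  bounded-E : ∀ x y u → Bounded true y x u → Bounded true x y (E u)
  bounded-E x y u bnd l v r p s s′ eq lm ne par e e′ =
    subst₂ _<_ (cong (b *_) (cong₂ _+_ (weight-E y x p) (+-comm y x))) (cong (λ w → c * w + b) (weight-E y x v))
      (bnd (E l) (E v) (E r) (E p) (E s) (E s′) (E-++₃ l v r eq)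
        (λ {l′} {v′} {a} q q′ → lm (trans (E-swap q) (map-++ not l′ (a ∷ []))) (trans (E-swap q′) (map-++ not v′ (a ∷ []))))
        (λ { q → ne (E-swap q) }) (trans (parity-E v) par)
        (trans (sym (map-++ not v r)) (trans (cong E e) (map-++ not p s)))
        (trans (cong E e′) (map-++ not p s′)))

  bounded-[] : ∀ d x y → Bounded d x y []
  bounded-[] d x y []      []      r p s s′ eq lm ne = ⊥-elim (ne refl)
  bounded-[] d x y []      (_ ∷ _) r p s s′ ()
  bounded-[] d x y (_ ∷ _) v       r p s s′ ()

-- y² − 2 x² = ±1, with the bounds that follow from it.
Pell : ℕ → ℕ → Set
Pell x y = (0 < x) × (x ≤ y) × (y ≤ x + x) × ((y * y + 1 ≡ 2 * (x * x)) ⊎ (y * y ≡ 2 * (x * x) + 1))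

-- These are the weights under ψ, the exchange and ψ again: (x, y), (x, x + y), (x + y, x), (x + y,
-- 2x + y). The sign of y² - 2x² changes.
pell-step : ∀ x y → Pell x y → Pell (x + y) ((x + y) + x)
pell-step x y (x>0 , x≤y , y≤2x , eq) =
  ≤-trans x>0 (m≤m+n x y) , m≤m+n (x + y) x , +-monoʳ-≤ (x + y) (m≤m+n x y) , norm eq
  where
  open ≡-Reasoning
  expand₁ : ∀ x y → ((x + y) + x) * ((x + y) + x) + y * y ≡ 2 * ((x + y) * (x + y)) + 2 * (x * x)
  expand₁ = solve-∀
  norm : ((y * y + 1 ≡ 2 * (x * x)) ⊎ (y * y ≡ 2 * (x * x) + 1)) →
    (((x + y) + x) * ((x + y) + x) + 1 ≡ 2 * ((x + y) * (x + y))) ⊎ (((x + y) + x) * ((x + y) + x) ≡ 2 * ((x + y) * (x + y)) + 1)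
  norm (inj₁ e) = inj₂ (+-cancelʳ-≡ (y * y) _ _ (begin
    ((x + y) + x) * ((x + y) + x) + y * y        ≡⟨ expand₁ x y ⟩
    2 * ((x + y) * (x + y)) + 2 * (x * x)        ≡⟨ cong (2 * ((x + y) * (x + y)) +_) (trans (sym e) (+-comm (y * y) 1)) ⟩
    2 * ((x + y) * (x + y)) + (1 + y * y)        ≡⟨ +-assoc _ 1 (y * y) ⟨
    2 * ((x + y) * (x + y)) + 1 + y * y          ∎))
  norm (inj₂ e) = inj₁ (+-cancelʳ-≡ (2 * (x * x)) _ _ (begin
    ((x + y) + x) * ((x + y) + x) + 1 + 2 * (x * x)   ≡⟨ +-assoc (((x + y) + x) * ((x + y) + x)) 1 _ ⟩
    ((x + y) + x) * ((x + y) + x) + (1 + 2 * (x * x)) ≡⟨ cong (((x + y) + x) * ((x + y) + x) +_) (trans (+-comm 1 _) (sym e)) ⟩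
    ((x + y) + x) * ((x + y) + x) + y * y             ≡⟨ expand₁ x y ⟩
    2 * ((x + y) * (x + y)) + 2 * (x * x)             ∎))

-- For norm -1 the number x exceeds y/√2; lowering x by 1 compensates for this.
pell-lower : ∀ x′ y → Pell (suc x′) y → 2 * (x′ * x′) ≤ y * y
pell-lower x′ y (_ , _ , _ , eq) = +-cancelʳ-≤ 1 _ _ (≤-trans (m≤m+n _ (4 * x′ + 1)) (≤-trans (≤-reflexive (expand x′)) (bound eq)))
  where
  expand : ∀ x → 2 * (x * x) + 1 + (4 * x + 1) ≡ 2 * (suc x * suc x)
  expand = solve-∀
  bound : ((y * y + 1 ≡ 2 * (suc x′ * suc x′)) ⊎ (y * y ≡ 2 * (suc x′ * suc x′) + 1)) → 2 * (suc x′ * suc x′) ≤ y * y + 1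
  bound (inj₁ e) = ≤-reflexive (sym e)
  bound (inj₂ e) = ≤-trans (m≤m+n _ 1) (≤-trans (≤-reflexive (sym e)) (m≤m+n _ 1))

even-weight : ∀ x y v → y ≤ x + x → v ≢ [] → parity false v ≡ false → y ≤ weight x y v
even-weight x y []                  le ne par = ⊥-elim (ne refl)
even-weight x y (true ∷ v)          le ne par = m≤m+n y _
even-weight x y (false ∷ false ∷ v) le ne par = ≤-trans le (+-monoʳ-≤ x (m≤m+n x _))
even-weight x y (false ∷ true ∷ v)  le ne par = ≤-trans (m≤m+n y _) (m≤n+m _ x)

-- The word 11 would be the only exception, and it is not a factor of an image under ψ.
even-length-weight : ∀ x y u l v r → y ≤ x → ψ̂ u ≡ l ++ v ++ r → v ≢ [] → parity true v ≡ false → x + y ≤ weight x y v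
even-length-weight x y u l []                  r le eq ne par = ⊥-elim (ne refl)
even-length-weight x y u l (false ∷ false ∷ v) r le eq ne par = +-monoʳ-≤ x (≤-trans le (m≤m+n x _))
even-length-weight x y u l (false ∷ true ∷ v)  r le eq ne par = +-monoʳ-≤ x (m≤m+n y _)
even-length-weight x y u l (true ∷ false ∷ v)  r le eq ne par = ≤-trans (≤-reflexive (+-comm x y)) (+-monoʳ-≤ y (m≤m+n x _))
even-length-weight x y u l (true ∷ true ∷ v)   r le eq ne par with () ← ψ̂-before-true u l eq

-- The Sturmian word and the infinite Rote word

substitute : Word → Word
substitute z = ψ̂ (E (ψ̂ z))

sturmian : ℕ → Word
sturmian zero    = []
sturmian (suc n) = substitute (sturmian n)

-- The exchange respects `Rote true` only, so it sits between two applications of `ψ̂`, each of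
-- which switches between the two forms of `Rote`.
allRote-sturmian : ∀ n → AllRote false (sturmian n)
allRote-sturmian zero    = tt
allRote-sturmian (suc n) = allRote-ψ̂ false _ (allRote-E _ (allRote-ψ̂ true _ (allRote-sturmian n)))

substitute-prefix : ∀ u v → ∃[ t ] substitute (u ++ v) ≡ substitute u ++ t
substitute-prefix u v with ψ̂-prefix u v
... | t , e with ψ̂-prefix (E (ψ̂ u)) (E t)
...   | t′ , e′ = t′ , trans (cong ψ̂ (trans (cong E e) (map-++ not (ψ̂ u) t))) e′

sturmian-prefix : ∀ n → ∃[ t ] sturmian (suc n) ≡ sturmian n ++ t
sturmian-prefix zero    = _ , refl
sturmian-prefix (suc n) with sturmian-prefix n
... | t , e with substitute-prefix (sturmian n) t
...   | t′ , e′ = t′ , trans (cong substitute e) e′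

length-ψ̂ : ∀ u → suc (length u) ≤ length (ψ̂ u)
length-ψ̂ []          = s≤s z≤n
length-ψ̂ (false ∷ u) = s≤s (length-ψ̂ u)
length-ψ̂ (true ∷ u)  = s≤s (m≤n⇒m≤1+n (length-ψ̂ u))

sturmian-length : ∀ n → n ≤ length (sturmian n)
sturmian-length zero    = z≤n
sturmian-length (suc n) = ≤-trans (s≤s (≤-trans (sturmian-length n)
  (≤-trans (n≤1+n _) (≤-trans (length-ψ̂ (sturmian n)) (≤-reflexive (sym (length-map not (ψ̂ (sturmian n)))))))))
  (length-ψ̂ (E (ψ̂ (sturmian n))))

Occurs : InfWord → ℕ → Word → Set
Occurs w i []      = ⊤
Occurs w i (c ∷ u) = w i ≡ c × Occurs w (suc i) u

occurs-++⁻ʳ : ∀ w i u {v} → Occurs w i (u ++ v) → Occurs w (i + length u) v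
occurs-++⁻ʳ w i []      {v} o   = subst (λ j → Occurs w j v) (sym (+-identityʳ i)) o
occurs-++⁻ʳ w i (c ∷ u) {v} (_ , o) = subst (λ j → Occurs w j v) (sym (+-suc i (length u))) (occurs-++⁻ʳ w (suc i) u o)

occurs-++⁻ˡ : ∀ w i u {v} → Occurs w i (u ++ v) → Occurs w i u
occurs-++⁻ˡ w i []      o       = tt
occurs-++⁻ˡ w i (c ∷ u) (e , o) = e , occurs-++⁻ˡ w (suc i) u o

letters : InfWord → ℕ → ℕ → Word
letters w i zero    = []
letters w i (suc n) = w i ∷ letters w (suc i) n

factorAt-letters : ∀ w i n → factorAt w i n ≡ letters w i n
factorAt-letters w i n = trans (map-upTo (λ k → w (i + k)) n) (go i n (λ k → w (i + k)) (λ k → refl))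
  where
  go : ∀ i n (h : ℕ → Bool) → (∀ k → h k ≡ w (i + k)) → applyUpTo h n ≡ letters w i n
  go i zero    h eq = refl
  go i (suc n) h eq = cong₂ _∷_ (trans (eq 0) (cong w (+-identityʳ i)))
    (go (suc i) n (h ∘ suc) (λ k → trans (eq (suc k)) (cong w (+-suc i k))))

occurs-letters : ∀ w i u → Occurs w i u → letters w i (length u) ≡ u
occurs-letters w i []      _       = refl
occurs-letters w i (c ∷ u) (e , o) = cong₂ _∷_ e (occurs-letters w (suc i) u o)

letters-+ : ∀ w i m n → letters w i (m + n) ≡ letters w i m ++ letters w (i + m) n
letters-+ w i zero    n = cong (λ j → letters w j n) (sym (+-identityʳ i))
letters-+ w i (suc m) n = cong (w i ∷_) (trans (letters-+ w (suc i) m n) (cong (λ j → letters w (suc i) m ++ letters w j n) (sym (+-suc i m))))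

infix-letters : ∀ w i n N → i + n ≤ N → Infix (letters w i n) (letters w 0 N)
infix-letters w i n N le with m≤n⇒∃[o]m+o≡n le
... | o , refl = letters w 0 i , letters w (i + n) o ,
  trans (cong (letters w 0) (+-assoc i n o)) (trans (letters-+ w 0 i (n + o)) (cong (letters w 0 i ++_) (letters-+ w i n o)))

at : Word → ℕ → Bool
at []      _       = false
at (c ∷ u) zero    = c
at (c ∷ u) (suc n) = at u n

at-++ : ∀ u v k → k < length u → at (u ++ v) k ≡ at u k
at-++ (c ∷ u) v zero    _        = refl
at-++ (c ∷ u) v (suc k) (s≤s lt) = at-++ u v k lt

rotePrefix : ℕ → Word
rotePrefix n = integrate false (sturmian n)

-- The k-th prefix has more than k letters, so the default value of `at` is never read.
roteWord : InfWord
roteWord k = at (rotePrefix k) k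

rotePrefix-suc : ∀ n → ∃[ t ] rotePrefix (suc n) ≡ rotePrefix n ++ t
rotePrefix-suc n with sturmian-prefix n
... | t , e with integrate-prefix false (sturmian n) t
...   | t′ , e′ = t′ , trans (cong (integrate false) e) e′

rotePrefix-+ : ∀ n k → ∃[ t ] rotePrefix (k + n) ≡ rotePrefix n ++ t
rotePrefix-+ n zero    = [] , sym (++-identityʳ _)
rotePrefix-+ n (suc k) with rotePrefix-+ n k | rotePrefix-suc (k + n)
... | t , e | t′ , e′ = t ++ t′ , trans e′ (trans (cong (_++ t′) e) (++-assoc (rotePrefix n) t t′))

length-integrate : ∀ b u → length (integrate b u) ≡ suc (length u)
length-integrate b []          = refl
length-integrate b (false ∷ u) = cong suc (length-integrate (not b) u)
length-integrate b (true ∷ u)  = cong suc (length-integrate b u)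

rotePrefix-length : ∀ n → n < length (rotePrefix n)
rotePrefix-length n = subst (n <_) (sym (length-integrate false (sturmian n))) (s≤s (sturmian-length n))

roteWord-at : ∀ n k → k < length (rotePrefix n) → roteWord k ≡ at (rotePrefix n) k
roteWord-at n k lt with ≤-total n k
... | inj₁ n≤k with m≤n⇒∃[o]m+o≡n n≤k
...   | o , refl with rotePrefix-+ n o
...     | t , e = trans (cong (λ j → at (rotePrefix j) (n + o)) (+-comm n o)) (trans (cong (λ x → at x (n + o)) e) (at-++ (rotePrefix n) t _ lt))
roteWord-at n k lt | inj₂ k≤n with m≤n⇒∃[o]m+o≡n k≤n
... | o , refl with rotePrefix-+ k o
...   | t , e = sym (trans (cong (λ j → at (rotePrefix j) k) (+-comm k o)) (trans (cong (λ x → at x k) e) (at-++ (rotePrefix k) t _ (rotePrefix-length k))))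

occurs-at : ∀ w u i → (∀ k → k < length u → w (i + k) ≡ at u k) → Occurs w i u
occurs-at w []      i eq = tt
occurs-at w (c ∷ u) i eq = trans (cong w (sym (+-identityʳ i))) (eq 0 (s≤s z≤n)) ,
  occurs-at w u (suc i) (λ k lt → trans (cong w (sym (+-suc i k))) (eq (suc k) (s≤s lt)))

occurs-rotePrefix : ∀ n → Occurs roteWord 0 (rotePrefix n)
occurs-rotePrefix n = occurs-at roteWord (rotePrefix n) 0 (roteWord-at n)

roteWord-rich : RichInf roteWord
roteWord-rich i n = rich-infix inf (allNew⇒rich (rotePrefix N) (allNew-integrate false _ (allRote-sturmian N)))
  where
  N = i + n
  inf : Infix (factorAt roteWord i n) (rotePrefix N)
  inf = subst₂ Infix (sym (factorAt-letters roteWord i n)) (occurs-letters roteWord 0 _ (occurs-rotePrefix N))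
    (infix-letters roteWord i n _ (<⇒≤ (rotePrefix-length N)))

-- Difference words

same : Bool → Bool → Bool
same x y = not (x xor y)

differences : InfWord → ℕ → ℕ → Word
differences w i zero    = []
differences w i (suc n) = same (w i) (w (suc i)) ∷ differences w (suc i) n

differences-+ : ∀ w i m n → differences w i (m + n) ≡ differences w i m ++ differences w (i + m) n
differences-+ w i zero    n = cong (λ j → differences w j n) (sym (+-identityʳ i))
differences-+ w i (suc m) n = cong (same (w i) (w (suc i)) ∷_)
  (trans (differences-+ w (suc i) m n) (cong (λ j → differences w (suc i) m ++ differences w j n) (sym (+-suc i m))))

length-differences : ∀ w i n → length (differences w i n) ≡ n
length-differences w i zero    = refl
length-differences w i (suc n) = cong suc (length-differences w (suc i) n)

parity-differences : ∀ w i n → parity false (differences w i n) ≡ w i xor w (i + n)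
parity-differences w i zero    = sym (trans (cong (λ j → w i xor w j) (+-identityʳ i)) (xor-same (w i)))
parity-differences w i (suc n) = step (w i) (w (suc i)) _ _
  (trans (parity-differences w (suc i) n) (cong (λ j → w (suc i) xor w j) (sym (+-suc i n))))
  where
  step : ∀ x y z u → parity false u ≡ y xor z → parity false (same x y ∷ u) ≡ x xor z
  step false false z u e = e
  step true  true  z u e = e
  step false true  z u e = trans (cong not e) (not-involutive z)
  step true  false z u e = cong not e

differences-∷ʳ : ∀ w i n → differences w i (suc n) ≡ differences w i n ∷ʳ same (w (i + n)) (w (suc (i + n)))
differences-∷ʳ w i n = trans (cong (differences w i) (+-comm 1 n)) (differences-+ w i n 1)

occurs-integrate : ∀ w i b u → Occurs w i (integrate b u) → u ≡ differences w i (length u)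
occurs-integrate w i b []          o       = refl
occurs-integrate w i b (false ∷ u) (e , o) with integrate-head (not b) u
... | t , h = cong₂ _∷_ (sym (trans (cong₂ same e (proj₁ (subst (Occurs w (suc i)) h o))) (same-not b))) (occurs-integrate w (suc i) (not b) u o)
  where
  same-not : ∀ b → same b (not b) ≡ false
  same-not false = refl
  same-not true  = refl
occurs-integrate w i b (true ∷ u) (e , o) with integrate-head b u
... | t , h = cong₂ _∷_ (sym (trans (cong₂ same e (proj₁ (subst (Occurs w (suc i)) h o))) (cong not (xor-same b)))) (occurs-integrate w (suc i) b u o)

differences-periodic : ∀ w i j n → (∀ k → k ≤ n → w (i + k) ≡ w (j + k)) → differences w i n ≡ differences w j n
differences-periodic w i j zero    eq = refl
differences-periodic w i j (suc n) eq = cong₂ _∷_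
  (cong₂ same (trans (cong w (sym (+-identityʳ i))) (trans (eq 0 z≤n) (cong w (+-identityʳ j)))) (shift 0 z≤n′))
  (differences-periodic w (suc i) (suc j) n (λ k le → trans (cong w (sym (+-suc i k))) (trans (eq (suc k) (s≤s le)) (cong w (+-suc j k)))))
  where
  z≤n′ : 1 ≤ suc n
  z≤n′ = s≤s z≤n
  shift : ∀ k → suc k ≤ suc n → w (suc i) ≡ w (suc j)
  shift _ _ = trans (cong w (sym (trans (+-suc i 0) (cong suc (+-identityʳ i))))) (trans (eq 1 z≤n′) (cong w (trans (+-suc j 0) (cong suc (+-identityʳ j)))))

same-injectiveʳ : ∀ x x′ y → same x y ≡ same x′ y → x ≡ x′
same-injectiveʳ false false y     e = refl
same-injectiveʳ true  true  y     e = refl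
same-injectiveʳ false true  false ()
same-injectiveʳ false true  true  ()
same-injectiveʳ true  false false ()
same-injectiveʳ true  false true  ()

-- Freeness above the threshold

module _ (a b : ℕ) (b>0 : 0 < b) (large : 2 * (b * b) < (2 * a ∸ 4 * b) ^ 2) where
  private
    c e : ℕ
    c = a ∸ b
    e = 2 * a ∸ 4 * b

    large′ : 2 * (b * b) < e * e
    large′ = subst (2 * (b * b) <_) (cong (e *_) (*-identityʳ e)) large

    4b≤2a : 4 * b ≤ 2 * a
    4b≤2a with ≤-total (4 * b) (2 * a)
    ... | inj₁ le = le
    ... | inj₂ ge = ⊥-elim (n≮0 (subst (2 * (b * b) <_) (cong (λ x → x * x) (m≤n⇒m∸n≡0 ge)) large′))

    2b≤a : 2 * b ≤ a
    2b≤a = *-cancelˡ-≤ 2 (subst (_≤ 2 * a) (*-assoc 2 2 b) 4b≤2a)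

    b+c≡a : b + c ≡ a
    b+c≡a = m+[n∸m]≡n (≤-trans (m≤m+n b _) 2b≤a)

    b≤c : b ≤ c
    b≤c = +-cancelˡ-≤ b b c (subst₂ _≤_ (cong (b +_) (+-identityʳ b)) (sym b+c≡a) 2b≤a)

    e+2b≡2c : e + 2 * b ≡ 2 * c
    e+2b≡2c = +-cancelʳ-≡ (2 * b) _ _ (begin
      e + 2 * b + 2 * b   ≡⟨ lem e b ⟩
      e + 4 * b           ≡⟨ m∸n+n≡m 4b≤2a ⟩
      2 * a               ≡⟨ cong (2 *_) b+c≡a ⟨
      2 * (b + c)         ≡⟨ lem′ b c ⟩
      2 * c + 2 * b       ∎)
      where
      open ≡-Reasoning
      lem : ∀ e b → e + 2 * b + 2 * b ≡ e + 4 * b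
      lem = solve-∀
      lem′ : ∀ b c → 2 * (b + c) ≡ 2 * c + 2 * b
      lem′ = solve-∀

    open Bound b c

    -- This is the case of an empty overlap and the lightest even period, of weight y; the exponent
    -- 1 + (x + y - 1)/y tends to 2 + √2/2. If the bound failed, then ey ≤ 2b(x - 1), against e² >
    -- 2b² and 2(x - 1)² ≤ y².
    critical : ∀ x y → Pell x y → b * (x + y) < c * y + b
    critical (suc x) y pell@(_ , x≤y , _) with b * (suc x + y) <? c * y + b
    ... | yes lt = lt
    ... | no ≮ = ⊥-elim (<⇒≱ below above)
      where
      below : 2 * (b * b) * (y * y) < e * e * (y * y)
      below = *-monoˡ-< (y * y) {{>-nonZero (*-mono-≤ y>0 y>0)}} large′
        where y>0 = ≤-trans (s≤s z≤n) x≤y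
      ey≤2bx : e * y ≤ 2 * b * x
      ey≤2bx = +-cancelʳ-≤ (2 * b * y + 2 * b) _ _ (begin
        e * y + (2 * b * y + 2 * b)     ≡⟨ lem₁ e b y ⟩
        (e + 2 * b) * y + 2 * b         ≡⟨ cong (λ z → z * y + 2 * b) e+2b≡2c ⟩
        2 * c * y + 2 * b               ≡⟨ lem₂ c y b ⟩
        2 * (c * y + b)                 ≤⟨ *-monoʳ-≤ 2 (≮⇒≥ ≮) ⟩
        2 * (b * (suc x + y))           ≡⟨ lem₃ b x y ⟩
        2 * b * x + (2 * b * y + 2 * b) ∎)
        where
        open ≤-Reasoning
        lem₁ : ∀ e b y → e * y + (2 * b * y + 2 * b) ≡ (e + 2 * b) * y + 2 * b
        lem₁ = solve-∀
        lem₂ : ∀ c y b → 2 * c * y + 2 * b ≡ 2 * (c * y + b)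
        lem₂ = solve-∀
        lem₃ : ∀ b x y → 2 * (b * (suc x + y)) ≡ 2 * b * x + (2 * b * y + 2 * b)
        lem₃ = solve-∀
      above : e * e * (y * y) ≤ 2 * (b * b) * (y * y)
      above = begin
        e * e * (y * y)                 ≡⟨ lem₁ e y ⟩
        (e * y) * (e * y)               ≤⟨ *-mono-≤ ey≤2bx ey≤2bx ⟩
        (2 * b * x) * (2 * b * x)       ≡⟨ lem₂ b x ⟩
        2 * (b * b) * (2 * (x * x))     ≤⟨ *-monoʳ-≤ (2 * (b * b)) (pell-lower x y pell) ⟩
        2 * (b * b) * (y * y)           ∎
        where
        open ≤-Reasoning
        lem₁ : ∀ e y → e * e * (y * y) ≡ (e * y) * (e * y)
        lem₁ = solve-∀
        lem₂ : ∀ b x → (2 * b * x) * (2 * b * x) ≡ 2 * (b * b) * (2 * (x * x))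
        lem₂ = solve-∀

    -- A repetition is desubstituted until its overlap is empty. If the number of letters 0 in the
    -- period is even there, the period weighs at least y, and `critical` is the tight estimate.
    -- Between the two applications of ψ its length is even, so it weighs at least the sum of the
    -- two weights, and b ≤ c suffices.
    bounded-sturmian : ∀ n x y → Pell x y → Bounded false x y (sturmian n)
    bounded-sturmian zero    x y pell = bounded-[] false x y
    bounded-sturmian (suc n) x y pell@(x>0 , x≤y , y≤2x , _) =
      bounded-ψ̂ false x y _ base-false
        (bounded-E x (x + y) _
          (bounded-ψ̂ true (x + y) x _ base-true (bounded-sturmian n _ _ (pell-step x y pell))))
      where
      base-false : BoundedPeriod false x y (substitute (sturmian n))
      base-false l v r eq ne par = <-≤-trans (critical x y pell)
        (+-monoˡ-≤ b (*-monoʳ-≤ c (even-weight x y v y≤2x ne par)))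
      base-true : BoundedPeriod true (x + y) x (ψ̂ (sturmian n))
      base-true l v r eq ne par = ≤-<-trans
        (*-mono-≤ b≤c (even-length-weight (x + y) x (sturmian n) l v r (m≤m+n x y) eq ne par))
        (m<m+n _ b>0)

    w : InfWord
    w = roteWord

    -- Stated without subtraction: the repetition has length p + suc k.
    no-maximal-power : ∀ i k p → 0 < p → (∀ j → j ≤ k → w (i + j) ≡ w (i + j + p)) →
      (∀ i′ → i ≡ suc i′ → w i′ ≢ w (i′ + p)) → b * suc k < c * p
    no-maximal-power i k p p>0 per lm = +-cancelʳ-< b _ _ (begin-strict
      b * suc k + b                        ≡⟨ lem b k ⟩
      b * (k + 2)                          ≡⟨ cong (λ z → b * (z + 2)) (trans (weight-length (differences w i k)) (length-differences w i k)) ⟨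
      b * (weight 1 1 (differences w i k) + 2)
        -- For the Pell pair (1, 1) the weight is the length. An overlap of `suc k` letters has only
        -- k differences; the missing letter is the x + y - 1 of `Bounded`.
        <⟨ bounded-sturmian N 1 1 (s≤s z≤n , ≤-refl , s≤s z≤n , inj₁ refl)
             (differences w 0 i) (differences w i p) (differences w (i + p) (k + o)) (differences w i k)
             _ _ split (λ {_} {_} {_} → left-max i p p>0 lm per) nonempty even first second ⟩
      c * weight 1 1 (differences w i p) + b ≡⟨ cong (λ z → c * z + b) (trans (weight-length (differences w i p)) (length-differences w i p)) ⟩
      c * p + b                            ∎)
      where
      open ≤-Reasoning
      lem : ∀ b k → b * suc k + b ≡ b * (k + 2)
      lem = solve-∀
      N = i + (p + k)
      o : ℕ
      o = proj₁ (m≤n⇒∃[o]m+o≡n (sturmian-length N))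
      len : i + (p + (k + o)) ≡ length (sturmian N)
      len = trans (lem′ i p k o) (proj₂ (m≤n⇒∃[o]m+o≡n (sturmian-length N)))
        where
        lem′ : ∀ i p k o → i + (p + (k + o)) ≡ i + (p + k) + o
        lem′ = solve-∀
      split : sturmian N ≡ differences w 0 i ++ differences w i p ++ differences w (i + p) (k + o)
      split = trans (occurs-integrate w 0 false (sturmian N) (occurs-rotePrefix N))
        (trans (cong (differences w 0) (sym len))
          (trans (differences-+ w 0 i (p + (k + o))) (cong (differences w 0 i ++_) (differences-+ w i p (k + o)))))
      even : parity false (differences w i p) ≡ false
      even = trans (parity-differences w i p)
        (trans (cong (_xor w (i + p)) (trans (cong w (sym (+-identityʳ i))) (trans (per 0 z≤n) (cong (λ j → w (j + p)) (+-identityʳ i)))))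
          (xor-same (w (i + p))))
      nonempty : differences w i p ≢ []
      nonempty eq = <⇒≢ p>0 (trans (cong length (sym eq)) (length-differences w i p))
      first : differences w i p ++ differences w (i + p) (k + o) ≡ differences w i k ++ differences w (i + k) (p + o)
      first = trans (sym (differences-+ w i p (k + o)))
        (trans (cong (differences w i) (lem′ p k o)) (differences-+ w i k (p + o)))
        where
        lem′ : ∀ p k o → p + (k + o) ≡ k + (p + o)
        lem′ = solve-∀
      second : differences w (i + p) (k + o) ≡ differences w i k ++ differences w (i + p + k) o
      second = trans (differences-+ w (i + p) k o) (cong (_++ differences w (i + p + k) o)
        (sym (differences-periodic w i (i + p) k (λ j le → trans (per j le) (cong w (lem′ i j p))))))
        where
        lem′ : ∀ i j p → i + j + p ≡ i + p + j
        lem′ = solve-∀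
      left-max : ∀ i p → 0 < p → (∀ i′ → i ≡ suc i′ → w i′ ≢ w (i′ + p)) →
        (∀ j → j ≤ k → w (i + j) ≡ w (i + j + p)) → LeftMaximal (differences w 0 i) (differences w i p)
      left-max zero    p       _ lm per {[]}    () _
      left-max zero    p       _ lm per {_ ∷ _} () _
      left-max (suc i) (suc p) _ lm per {l′} {v′} eq eq′ = lm i refl
        (same-injectiveʳ (w i) (w (i + suc p)) (w (suc i))
          (trans (∷ʳ-injectiveʳ (differences w 0 i) l′ (trans (sym (differences-∷ʳ w 0 i)) eq))
            (trans (sym (∷ʳ-injectiveʳ (differences w (suc i) p) v′ (trans (sym (differences-∷ʳ w (suc i) p)) eq′)))
              (cong₂ same (cong w (sym (+-suc i p))) (trans (cong w (cong suc (sym (+-suc i p))))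
                (sym (trans (cong w (sym (+-identityʳ (suc i)))) (trans (per 0 z≤n) (cong (λ j → w (suc j + suc p)) (+-identityʳ i))))))))))

    -- Moving the start to the left while the period persists only lengthens the overlap, and a
    -- repetition at position 0 is left maximal.
    no-power : ∀ i k p → 0 < p → (∀ j → j ≤ k → w (i + j) ≡ w (i + j + p)) → b * suc k < c * p
    no-power zero    k p p>0 per = no-maximal-power zero k p p>0 per (λ _ ())
    no-power (suc i) k p p>0 per with w i ≟B w (i + p)
    ... | no ne  = no-maximal-power (suc i) k p p>0 per (λ { _ refl → ne })
    ... | yes eq = ≤-<-trans (*-monoʳ-≤ b (n≤1+n (suc k))) (no-power i (suc k) p p>0 per′)
      where
      per′ : ∀ j → j ≤ suc k → w (i + j) ≡ w (i + j + p)
      per′ zero    _        = trans (cong w (+-identityʳ i)) (trans eq (cong (λ j → w (j + p)) (sym (+-identityʳ i))))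
      per′ (suc j) (s≤s le) = trans (cong w (+-suc i j)) (trans (per j le) (cong (λ j → w (j + p)) (sym (+-suc i j))))

  roteWord-free : Free a b roteWord
  roteWord-free (i , m , p , m>0 , p>0 , per , ap≤mb) with m ≤? p
  ... | yes m≤p = <⇒≱ (≤-<-trans (*-monoˡ-≤ b m≤p) p*b<a*p) ap≤mb
    where
    p*b<a*p : p * b < a * p
    p*b<a*p = subst (_< a * p) (*-comm b p) (*-monoˡ-< p {{>-nonZero p>0}}
      (subst (b <_) b+c≡a (m<m+n b (≤-trans b>0 b≤c))))
  ... | no m≰p with m≤n⇒∃[o]m+o≡n (≰⇒> m≰p)
  ...   | k , refl = <⇒≱ (no-power i k p p>0 (λ j le → per j (s≤s (≤-trans (+-monoˡ-≤ p le) (≤-reflexive (+-comm k p))))))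
    (+-cancelˡ-≤ (b * p) _ _ (begin
      b * p + c * p           ≡⟨ *-distribʳ-+ p b c ⟨
      (b + c) * p             ≡⟨ cong (_* p) b+c≡a ⟩
      a * p                   ≤⟨ ap≤mb ⟩
      (suc p + k) * b         ≡⟨ lem b p k ⟩
      b * p + b * suc k       ∎))
    where
    open ≤-Reasoning
    lem : ∀ b p k → (suc p + k) * b ≡ b * p + b * suc k
    lem = solve-∀

-- Codings by marked palindromes

Ternary : Set
Ternary = List (Fin 3)

allNew-suffix : ∀ {A : Set} (l : List A) {u} → AllNew (l ++ u) → AllNew u
allNew-suffix []      new       = new
allNew-suffix (a ∷ l) (_ , new) = allNew-suffix l new

++-marker : ∀ {A : Set} {z : A} {x s} {t} l → All (_≢ z) x → x ++ s ≡ l ++ z ∷ t →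
  ∃[ l′ ] (l ≡ x ++ l′ × s ≡ l′ ++ z ∷ t)
++-marker l       []        eq = l , refl , eq
++-marker []      (≢z ∷ _)  eq = ⊥-elim (≢z (∷-injectiveˡ eq))
++-marker (a ∷ l) (_ ∷ all) eq with ∷-injective eq
... | refl , eq′ with ++-marker l all eq′
...   | l′ , refl , e = l′ , refl , e

module Substitution {A : Set} (block : Fin 3 → List A) (z : A) where

  σ : Ternary → List A
  σ []      = []
  σ (c ∷ u) = block c ++ σ u

  σ̂ : Ternary → List A
  σ̂ u = σ u ∷ʳ z

  σ-++ : ∀ u v → σ (u ++ v) ≡ σ u ++ σ v
  σ-++ []      v = refl
  σ-++ (c ∷ u) v = trans (cong (block c ++_) (σ-++ u v)) (sym (++-assoc (block c) (σ u) (σ v)))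

  σ̂-++ : ∀ u v → σ̂ (u ++ v) ≡ σ u ++ σ̂ v
  σ̂-++ u v = trans (cong (_∷ʳ z) (σ-++ u v)) (++-assoc (σ u) (σ v) (z ∷ []))

-- The marker z occurs only at the start of a block, so it shows the block boundaries; as the rest
-- of each block is a palindrome, the closing z of `σ̂` makes it commute with reversal.
record Coding {A : Set} (z : A) (code : Fin 3 → List A) : Set where
  field
    marker-free     : ∀ c → All (_≢ z) (code c)
    code-palindrome : ∀ c → Palindrome (code c)
    code-injective  : ∀ c d → code c ≡ code d → c ≡ d

  open Substitution (λ c → z ∷ code c) z public

  σ̂-head : ∀ u → ∃[ t ] σ̂ u ≡ z ∷ t
  σ̂-head []      = _ , refl
  σ̂-head (c ∷ u) = _ , refl

  σ̂-infix : ∀ l u r → Infix (σ̂ u) (σ̂ (l ++ u ++ r))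
  σ̂-infix l u r with σ̂-head r
  ... | t , h = σ l , t , (begin
    σ̂ (l ++ u ++ r)        ≡⟨ σ̂-++ l (u ++ r) ⟩
    σ l ++ σ̂ (u ++ r)      ≡⟨ cong (σ l ++_) (σ̂-++ u r) ⟩
    σ l ++ σ u ++ σ̂ r      ≡⟨ cong (λ x → σ l ++ σ u ++ x) h ⟩
    σ l ++ σ u ++ z ∷ t    ≡⟨ cong (σ l ++_) (++-assoc (σ u) (z ∷ []) t) ⟨
    σ l ++ σ̂ u ++ t        ∎)
    where open ≡-Reasoning

  σ̂-reverse : ∀ u → reverse (σ̂ u) ≡ σ̂ (reverse u)
  σ̂-reverse []      = refl
  σ̂-reverse (c ∷ u) = begin
    reverse (z ∷ (code c ++ σ u) ++ z ∷ [])     ≡⟨ cong (λ x → reverse (z ∷ x)) (++-assoc (code c) (σ u) (z ∷ [])) ⟩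
    reverse ((z ∷ code c) ++ σ̂ u)               ≡⟨ reverse-++ (z ∷ code c) (σ̂ u) ⟩
    reverse (σ̂ u) ++ reverse (z ∷ code c)       ≡⟨ cong₂ _++_ (σ̂-reverse u) (trans (unfold-reverse z (code c)) (cong (_∷ʳ z) (code-palindrome c))) ⟩
    (σ (reverse u) ∷ʳ z) ++ code c ∷ʳ z         ≡⟨ ++-assoc (σ (reverse u)) (z ∷ []) _ ⟩
    σ (reverse u) ++ z ∷ code c ∷ʳ z            ≡⟨ cong (λ x → σ (reverse u) ++ z ∷ x ∷ʳ z) (++-identityʳ (code c)) ⟨
    σ (reverse u) ++ σ̂ (c ∷ [])                 ≡⟨ σ̂-++ (reverse u) (c ∷ []) ⟨
    σ̂ (reverse u ∷ʳ c)                          ≡⟨ cong σ̂ (unfold-reverse c u) ⟨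
    σ̂ (reverse (c ∷ u))                         ∎
    where open ≡-Reasoning

  σ̂-split : ∀ u l {x} → σ̂ u ≡ l ++ z ∷ x → ∃[ p ] ∃[ s ] (u ≡ p ++ s × l ≡ σ p × σ̂ s ≡ z ∷ x)
  σ̂-split u       []       eq = [] , u , refl , refl , eq
  σ̂-split []      (_ ∷ l)  eq with () ← ++-conicalʳ l _ (sym (∷-injectiveʳ eq))
  σ̂-split (c ∷ u) (_ ∷ l)  eq with ∷-injective eq
  ... | refl , eq′ with ++-marker l (marker-free c) (trans (sym (++-assoc (code c) (σ u) (z ∷ []))) eq′)
  ...   | l′ , refl , e with σ̂-split u l′ e
  ...     | p , s , refl , refl , e′ = c ∷ p , s , refl , refl , e′

  σ̂-injective : ∀ u v → σ̂ u ≡ σ̂ v → u ≡ v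
  σ̂-injective []      []      eq = refl
  σ̂-injective []      (d ∷ v) eq with () ← ++-conicalʳ (code d ++ σ v) _ (sym (∷-injectiveʳ eq))
  σ̂-injective (c ∷ u) []      eq with () ← ++-conicalʳ (code c ++ σ u) _ (∷-injectiveʳ eq)
  σ̂-injective (c ∷ u) (d ∷ v) eq with σ̂-head u | σ̂-head v
  ... | t , h | t′ , h′ with ++-marker (code c) (marker-free d)
          (sym (trans (sym (cong (code c ++_) h)) (trans (sym (++-assoc (code c) (σ u) (z ∷ []))) (trans (∷-injectiveʳ eq) (++-assoc (code d) (σ v) (z ∷ []))))))
  ...   | [] , e , e′ = cong₂ _∷_ (code-injective c d (trans e (++-identityʳ (code d)))) (σ̂-injective u v (trans h (sym e′)))
  ...   | a ∷ l′ , e , e′ = ⊥-elim (clash (code c) (marker-free c) e (∷-injectiveˡ (trans (sym h′) e′)))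
    where
    clash : ∀ x → All (_≢ z) x → x ≡ code d ++ a ∷ l′ → z ≡ a → ⊥
    clash x all refl za = All.lookup all (∈-++⁺ʳ (code d) (here refl)) (sym za)

  -- The new palindrome starts with the marker, hence ends with it. It is not z alone, which recurs
  -- at the end of `σ̂ u`, so it is the image of a nonempty prefix of `c ∷ u`. That prefix is a
  -- palindrome by injectivity, and a second occurrence of it would repeat its image.
  newPalindrome-σ̂ : ∀ c u → NewPalindrome z (code c ++ σ̂ u) → NewPalindrome c u
  newPalindrome-σ̂ c u (q , r , eq , pal , new) with initLast q
  ... | [] = ⊥-elim (new (code c ++ σ u , [] , sym (++-assoc (code c) (σ u) (z ∷ []))))
  ... | q₁ ∷ʳ′ a with ∷ʳ-injectiveʳ (reverse (q₁ ∷ʳ a)) (z ∷ q₁) (trans (sym (unfold-reverse z (q₁ ∷ʳ a))) pal)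
  ...   | refl with σ̂-split (c ∷ u) (z ∷ q₁) (cong (z ∷_) (trans (++-assoc (code c) (σ u) (z ∷ [])) (trans eq (++-assoc q₁ (z ∷ []) r))))
  ...     | [] , s , e , () , e″
  ...     | d ∷ p , s , refl , e′ , e″ = p , s , refl , pal-p , new′
    where
    image : z ∷ q₁ ∷ʳ z ≡ σ̂ (c ∷ p)
    image = cong (_∷ʳ z) e′
    pal-p : Palindrome (c ∷ p)
    pal-p = σ̂-injective _ _ (trans (sym (σ̂-reverse (c ∷ p))) (subst Palindrome image pal))
    new′ : ¬ Infix (c ∷ p) (p ++ s)
    new′ (l , r′ , o) = new (subst₂ Infix (sym image) (cong (λ x → code c ++ σ̂ x) (sym o))
      (infix-++ˡ (code c) (σ̂-infix l (c ∷ p) r′)))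

  allNew-σ̂ : ∀ u → AllNew (σ̂ u) → AllNew u
  allNew-σ̂ []      _            = tt
  allNew-σ̂ (c ∷ u) (new , rest) =
    newPalindrome-σ̂ c u (subst (NewPalindrome z) (++-assoc (code c) (σ u) (z ∷ [])) new) ,
    allNew-σ̂ u (allNew-suffix (code c) (subst AllNew (++-assoc (code c) (σ u) (z ∷ [])) rest))

module Languages (Goal : Set) where

  -- This collects what is used of the factors of w at any level of desubstitution. Reversal is a
  -- field because `rich-reverse` counts binary palindromes, whereas preimages are ternary. `Goal`
  -- will be a power in w: cubes are not excluded but turned into one.
  record Language {A : Set} (P : List A → Set) : Set where
    field
      factor-closed  : ∀ {u v} → Infix u v → P v → P u
      allNew         : ∀ u → P u → AllNew u
      allNew-reverse : ∀ u → P u → AllNew (reverse u)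
      cube           : ∀ v → v ≢ [] → P (v ++ v ++ v) → Goal

  module _ {A : Set} {z : A} {code : Fin 3 → List A} (coding : Coding z code) {P : List A → Set} (L : Language P) where
    open Coding coding
    open Language L

    preimage : Language (P ∘ σ̂)
    preimage = record
      { factor-closed  = λ { {u} (l , r , refl) p → factor-closed (σ̂-infix l u r) p }
      ; allNew         = λ u p → allNew-σ̂ u (allNew (σ̂ u) p)
      ; allNew-reverse = λ u p → allNew-σ̂ (reverse u) (subst AllNew (σ̂-reverse u) (allNew-reverse (σ̂ u) p))
      ; cube           = λ v ne p → cube (σ v) (nonempty v ne) (factor-closed ([] , z ∷ [] , cubes v) p)
      }
      where
      nonempty : ∀ v → v ≢ [] → σ v ≢ []
      nonempty []      ne _ = ne refl
      nonempty (_ ∷ _) ne ()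
      cubes : ∀ v → σ̂ (v ++ v ++ v) ≡ (σ v ++ σ v ++ σ v) ++ z ∷ []
      cubes v = cong (_∷ʳ z) (trans (σ-++ v (v ++ v)) (cong (σ v ++_) (σ-++ v v)))

-- Desubstitution by exhaustive search

∧-true : ∀ x {y} → x ∧ y ≡ true → x ≡ true × y ≡ true
∧-true true e = refl , e

∨-true : ∀ x {y} → x ∨ y ≡ true → x ≡ true ⊎ y ≡ true
∨-true true  e = inj₁ refl
∨-true false e = inj₂ e

any-true⁻ : ∀ {B : Set} (f : B → Bool) xs → any f xs ≡ true → ∃[ x ] (x ∈ xs × f x ≡ true)
any-true⁻ f (x ∷ xs) e with ∨-true (f x) e
... | inj₁ e′ = x , here refl , e′
... | inj₂ e′ with any-true⁻ f xs e′
...   | y , i , e″ = y , there i , e″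

any-true⁺ : ∀ {B : Set} (f : B → Bool) {x xs} → x ∈ xs → f x ≡ true → any f xs ≡ true
any-true⁺ f (here refl) e rewrite e = refl
any-true⁺ f {xs = y ∷ _} (there i) e with f y
... | true  = refl
... | false = any-true⁺ f i e

all-true⁻ : ∀ {B : Set} (f : B → Bool) {x xs} → all f xs ≡ true → x ∈ xs → f x ≡ true
all-true⁻ f {xs = y ∷ _} e (here refl) = proj₁ (∧-true (f y) e)
all-true⁻ f {xs = y ∷ _} e (there i)   = all-true⁻ f (proj₂ (∧-true (f y) e)) i

module Patterns {A : Set} (_≟_ : DecidableEquality A) where

  isPrefix : List A → List A → Bool
  isPrefix []      _       = true
  isPrefix (_ ∷ _) []      = false
  isPrefix (a ∷ u) (b ∷ v) = does (a ≟ b) ∧ isPrefix u v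

  isInfix : List A → List A → Bool
  isInfix u []      = isPrefix u []
  isInfix u (b ∷ v) = isPrefix u (b ∷ v) ∨ isInfix u v

  reversedInits : List A → List A → List (List A)
  reversedInits acc []      = []
  reversedInits acc (a ∷ u) = (a ∷ acc) ∷ reversedInits (a ∷ acc) u

  -- A reversed prefix is a palindrome as soon as it is itself a prefix.
  hasNew : List A → Bool
  hasNew []      = true
  hasNew (a ∷ u) = any (λ q → isPrefix q (a ∷ u) ∧ not (isInfix q u)) (reversedInits [] (a ∷ u))

  -- Adding a letter to a rich word can destroy richness only at the extended end, so a few suffixes
  -- of the word and of its reversal are enough.
  defective : ℕ → List A → Bool
  defective k u = any (not ∘ hasNew) (take k (tails u)) ∨ any (not ∘ hasNew) (take k (tails (reverse u)))

  agree : ℕ → List A → List A → Bool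
  agree zero    _       _       = true
  agree (suc n) (a ∷ u) (b ∷ v) = does (a ≟ b) ∧ agree n u v
  agree (suc n) _       _       = false

  hasPeriod : (ℕ → ℕ) → List A → ℕ → Bool
  hasPeriod ext u zero    = false
  hasPeriod ext u (suc p) = agree (ext (suc p)) u (drop (suc p) u)

  hasPower : (ℕ → ℕ) → List ℕ → List A → Bool
  hasPower ext ps u = any (λ p → any (λ s → hasPeriod ext s p) (tails u)) ps

  isPrefix-sound : ∀ u v → isPrefix u v ≡ true → ∃[ r ] v ≡ u ++ r
  isPrefix-sound []      v       e = v , refl
  isPrefix-sound (a ∷ u) (b ∷ v) e with a ≟ b
  ... | yes refl with isPrefix-sound u v e
  ...   | r , refl = r , refl

  isPrefix-complete : ∀ u r → isPrefix u (u ++ r) ≡ true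
  isPrefix-complete []      r = refl
  isPrefix-complete (a ∷ u) r with a ≟ a
  ... | yes _ = isPrefix-complete u r
  ... | no ne = ⊥-elim (ne refl)

  isInfix-sound : ∀ u v → isInfix u v ≡ true → Infix u v
  isInfix-sound u []      e with isPrefix-sound u [] e
  ... | r , eq = [] , r , eq
  isInfix-sound u (b ∷ v) e with ∨-true (isPrefix u (b ∷ v)) e
  ... | inj₁ e′ with isPrefix-sound u (b ∷ v) e′
  ...   | r , eq = [] , r , eq
  isInfix-sound u (b ∷ v) e | inj₂ e′ = infix-∷ (isInfix-sound u v e′)

  agree-sound : ∀ n u v → agree n u v ≡ true → ∃[ y ] ∃[ r ] ∃[ s ] (length y ≡ n × u ≡ y ++ r × v ≡ y ++ s)
  agree-sound zero    u       v       e = [] , u , v , refl , refl , refl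
  agree-sound (suc n) (a ∷ u) (b ∷ v) e with a ≟ b
  ... | yes refl with agree-sound n u v e
  ...   | y , r , s , refl , refl , refl = a ∷ y , r , s , refl , refl , refl

  hasPower-sound : ∀ ext ps u → hasPower ext ps u ≡ true →
    ∃[ l ] ∃[ s ] ∃[ p ] ∃[ y ] ∃[ r ] ∃[ r′ ]
      (u ≡ l ++ s × length y ≡ ext (suc p) × s ≡ y ++ r × drop (suc p) s ≡ y ++ r′)
  hasPower-sound ext ps u e with any-true⁻ _ ps e
  ... | p , _ , e₁ with any-true⁻ _ (tails u) e₁
  hasPower-sound ext ps u e | suc p , _ , e₁ | s , i , e₂ with ∈-tails⁻ s u i | agree-sound (ext (suc p)) s _ e₂
  ... | l , eq | y , r , r′ , len , e₃ , e₄ = l , s , p , y , r , r′ , eq , len , e₃ , e₄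

  ∈-reversedInits : ∀ acc a q r → q ʳ++ (a ∷ acc) ∈ reversedInits acc (a ∷ q ++ r)
  ∈-reversedInits acc a []      r = here refl
  ∈-reversedInits acc a (b ∷ q) r = there (∈-reversedInits (a ∷ acc) b q r)

  hasNew-complete : ∀ a u → NewPalindrome a u → hasNew (a ∷ u) ≡ true
  hasNew-complete a u (q , r , refl , pal , new) = any-true⁺ _
    (subst (_∈ reversedInits [] (a ∷ q ++ r)) pal (∈-reversedInits [] a q r)) (both (isPrefix-complete (a ∷ q) r))
    where
    both : isPrefix (a ∷ q) (a ∷ q ++ r) ≡ true → isPrefix (a ∷ q) (a ∷ q ++ r) ∧ not (isInfix (a ∷ q) (q ++ r)) ≡ true
    both e rewrite e with isInfix (a ∷ q) (q ++ r) in eq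
    ... | false = refl
    ... | true  = ⊥-elim (new (isInfix-sound (a ∷ q) (q ++ r) eq))

  noDefect : ∀ k u → AllNew u → any (not ∘ hasNew) (take k (tails u)) ≢ true
  noDefect zero    u       _            ()
  noDefect (suc zero)    []      _            ()
  noDefect (suc (suc k)) []      _            ()
  noDefect (suc k) (a ∷ u) (new , rest) e with ∨-true (not (hasNew (a ∷ u))) e
  ... | inj₂ e′ = noDefect k u rest e′
  ... | inj₁ e′ rewrite hasNew-complete a u new with () ← e′

  defective-sound : ∀ k u → AllNew u → AllNew (reverse u) → defective k u ≢ true
  defective-sound k u new new′ e with ∨-true (any (not ∘ hasNew) (take k (tails u))) e
  ... | inj₁ e′ = noDefect k u new e′
  ... | inj₂ e′ = noDefect k (reverse u) new′ e′

-- Depth-first extension of the factor l ++ r, alternately to the right and to the left, where r starts at a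
-- fixed position; a branch ends when r attains the goal or when the factor is bad.
module DepthFirst {A : Set} (alphabet : List A) (bad goal : List A → Bool) where

  search : ℕ → Bool → List A → List A → Bool
  search zero    _     l r = goal r ∨ bad (l ++ r)
  search (suc n) true  l r = goal r ∨ (bad (l ++ r) ∨ all (λ c → search n false l (r ∷ʳ c)) alphabet)
  search (suc n) false l r = goal r ∨ (bad (l ++ r) ∨ all (λ c → search n true (c ∷ l) r) alphabet)

  module _ (complete : ∀ a → a ∈ alphabet)
           {Goal : Set} {P : List A → Set} (closed : ∀ {u v} → Infix u v → P v → P u)
           (bad-sound : ∀ u → bad u ≡ true → P u → Goal)
           (Reached : List A → Set) (reached : ∀ r s → goal r ≡ true → Reached (r ++ s)) where

    private
      split : ∀ L l r R → P (L ʳ++ (l ++ r ++ R)) → P (l ++ r)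
      split L l r R = closed (reverse L , R , trans (ʳ++-defn L) (cong (reverse L ++_) (sym (++-assoc l r R))))

    -- `L` is the unread left context in reversed order, so that both contexts are consumed outwards
    -- from the current factor.
    search-sound : ∀ n d l r L R → search n d l r ≡ true → n ≤ length L → n ≤ length R →
      P (L ʳ++ (l ++ r ++ R)) → Goal ⊎ Reached (r ++ R)
    search-sound zero d l r L R e _ _ p with ∨-true (goal r) e
    ... | inj₁ g = inj₂ (reached r R g)
    ... | inj₂ b = inj₁ (bad-sound (l ++ r) b (split L l r R p))
    search-sound (suc n) true l r L (c ∷ R) e nL (s≤s nR) p with ∨-true (goal r) e
    ... | inj₁ g = inj₂ (reached r (c ∷ R) g)
    ... | inj₂ e′ with ∨-true (bad (l ++ r)) e′
    ...   | inj₁ b = inj₁ (bad-sound (l ++ r) b (split L l r (c ∷ R) p))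
    ...   | inj₂ s = subst (λ x → Goal ⊎ Reached x) (++-assoc r (c ∷ []) R)
      (search-sound n false l (r ∷ʳ c) L R (all-true⁻ _ s (complete c)) (<⇒≤ nL) nR
        (subst (λ x → P (L ʳ++ (l ++ x))) (sym (++-assoc r (c ∷ []) R)) p))
    search-sound (suc n) false l r (c ∷ L) R e (s≤s nL) nR p with ∨-true (goal r) e
    ... | inj₁ g = inj₂ (reached r R g)
    ... | inj₂ e′ with ∨-true (bad (l ++ r)) e′
    ...   | inj₁ b = inj₁ (bad-sound (l ++ r) b (split (c ∷ L) l r R p))
    ...   | inj₂ s = search-sound n true (c ∷ l) r L R (all-true⁻ _ s (complete c)) nL (<⇒≤ nR) p

letters₃ : Ternary
letters₃ = 0F ∷ 1F ∷ 2F ∷ []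

letters₃-complete : ∀ c → c ∈ letters₃
letters₃-complete 0F = here refl
letters₃-complete 1F = there (here refl)
letters₃-complete 2F = there (there (here refl))

module Parsing {A : Set} (_≟_ : DecidableEquality A) (alphabet : List A) (z : A)
               {I : Set} (indices : List I) (code : I → Fin 3 → List A) (bad : List A → Bool) (depth : ℕ) where

  open Patterns _≟_

  block : I → Fin 3 → List A
  block i c = z ∷ code i c

  followed : I → List A → Bool
  followed i r = any (λ c → isPrefix (block i c ∷ʳ z) r) letters₃

  markerSoon : List A → Bool
  markerSoon r = any (λ a → does (a ≟ z)) (take depth r)

  marker-found block-found : Bool
  marker-found = DepthFirst.search alphabet bad markerSoon depth true [] []
  block-found  = DepthFirst.search alphabet bad (λ r → any (λ i → followed i r) indices) depth true [] (z ∷ [])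

  -- The block just read is kept as left context, and the next block must have the same index: this
  -- is what prevents blocks of g and h from mixing.
  next-found : I → Fin 3 → Bool
  next-found i c = DepthFirst.search alphabet bad (followed i) depth true (block i c) (z ∷ [])

  parses : Bool
  parses = marker-found ∧ (block-found ∧ all (λ i → all (next-found i) letters₃) indices)

  -- A record, so that comparing two instances never runs the search.
  record Verified : Set where
    field parses-true : parses ≡ true

  module _ (complete : ∀ a → a ∈ alphabet) (indices-complete : ∀ i → i ∈ indices)
           (bound : ℕ) (block-bound : ∀ i c → length (block i c) ≤ bound)
           {Goal : Set} {P : List A → Set} (closed : ∀ {u v} → Infix u v → P v → P u)
           (bad-sound : ∀ u → bad u ≡ true → P u → Goal) (checked : Verified) where

    private
      open Verified checked
      check₁ = proj₁ (∧-true marker-found parses-true)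
      check₂ = proj₁ (∧-true block-found (proj₂ (∧-true marker-found parses-true)))
      check₃ = proj₂ (∧-true block-found (proj₂ (∧-true marker-found parses-true)))

    Followed : I → List A → Set
    Followed i x = ∃[ c ] ∃[ x′ ] x ≡ block i c ++ z ∷ x′

    MarkerSoon : List A → Set
    MarkerSoon x = ∃[ l ] ∃[ x′ ] (length l ≤ depth × x ≡ l ++ z ∷ x′)

    followed-sound : ∀ i r s → followed i r ≡ true → Followed i (r ++ s)
    followed-sound i r s e with any-true⁻ _ letters₃ e
    ... | c , _ , e′ with isPrefix-sound (block i c ∷ʳ z) r e′
    ...   | t , refl = c , t ++ s , trans (++-assoc (block i c ∷ʳ z) t s) (++-assoc (block i c) (z ∷ []) (t ++ s))

    some-followed-sound : ∀ r s → any (λ i → followed i r) indices ≡ true → ∃[ i ] Followed i (r ++ s)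
    some-followed-sound r s e with any-true⁻ _ indices e
    ... | i , _ , e′ = i , followed-sound i r s e′

    markerSoon-sound : ∀ r s → markerSoon r ≡ true → MarkerSoon (r ++ s)
    markerSoon-sound = go depth
      where
      go : ∀ n r s → any (λ a → does (a ≟ z)) (take n r) ≡ true → ∃[ l ] ∃[ x′ ] (length l ≤ n × r ++ s ≡ l ++ z ∷ x′)
      go (suc n) (a ∷ r) s e with a ≟ z
      ... | yes refl = [] , r ++ s , z≤n , refl
      ... | no _ with go n r s e
      ...   | l , x′ , le , eq = a ∷ l , x′ , s≤s le , cong (a ∷_) eq

    module σᵢ (i : I) = Substitution (block i) z

    length-block : ∀ n {i c} {x x′ : List A} → z ∷ x ≡ block i c ++ z ∷ x′ → bound + n ≤ length x → n ≤ length x′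
    length-block n {i} {c} {x} {x′} eq le = +-cancelˡ-≤ (bound + 1) n (length x′) (begin
      bound + 1 + n                             ≡⟨ lem₁ bound n ⟩
      suc (bound + n)                           ≤⟨ s≤s le ⟩
      length (z ∷ x)                            ≡⟨ cong length eq ⟩
      length (block i c ++ z ∷ x′)              ≡⟨ length-++ (block i c) ⟩
      length (block i c) + suc (length x′)      ≤⟨ +-monoˡ-≤ _ (block-bound i c) ⟩
      bound + suc (length x′)                   ≡⟨ lem₂ bound (length x′) ⟩
      bound + 1 + length x′                     ∎)
      where
      open ≤-Reasoning
      lem₁ : ∀ b n → b + 1 + n ≡ suc (b + n)
      lem₁ = solve-∀
      lem₂ : ∀ b n → b + suc n ≡ b + 1 + n
      lem₂ = solve-∀

    parse : ∀ i n c L x → depth ≤ length L → n * bound + depth ≤ length x → P (L ʳ++ (block i c ++ z ∷ x)) →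
      Goal ⊎ (∃[ u ] ∃[ x′ ] (length u ≡ n × z ∷ x ≡ σᵢ.σ i u ++ z ∷ x′))
    parse i zero    c L x dL dx p = inj₂ ([] , x , refl , refl)
    parse i (suc n) c L x dL dx p
      with DepthFirst.search-sound alphabet bad (followed i) complete closed bad-sound (Followed i) (followed-sound i)
             depth true (block i c) (z ∷ []) L x
             (all-true⁻ (next-found i) (all-true⁻ (λ j → all (next-found j) letters₃) check₃ (indices-complete i)) (letters₃-complete c))
             dL (≤-trans (m≤n+m depth (suc n * bound)) dx) p
    ... | inj₁ g = inj₁ g
    ... | inj₂ (c′ , x′ , eq)
      with parse i n c′ (block i c ʳ++ L) x′
             (≤-trans dL (≤-trans (m≤n+m _ (length (block i c))) (≤-reflexive (sym (length-ʳ++ (block i c))))))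
             (length-block (n * bound + depth) eq (≤-trans (≤-reflexive (sym (+-assoc bound (n * bound) depth))) dx))
             (subst P (trans (cong (λ y → L ʳ++ (block i c ++ y)) eq) (sym (ʳ++-ʳ++ (block i c)))) p)
    ...   | inj₁ g = inj₁ g
    ...   | inj₂ (u , x″ , len , eq′) = inj₂ (c′ ∷ u , x″ , cong suc len ,
      trans eq (trans (cong (block i c′ ++_) eq′) (sym (++-assoc (block i c′) (σᵢ.σ i u) (z ∷ x″)))))

    desubstitute : ∀ n → ∃[ N ] ∀ u → N ≤ length u → P u → Goal ⊎ (∃[ i ] ∃[ v ] (length v ≡ n × P (σᵢ.σ̂ i v)))
    -- In this order: left context for the searches, letters up to the first marker, the first
    -- block, which fixes the index and is not part of v, then n blocks and the lookahead of the
    -- last search.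
    desubstitute n = depth + (suc depth + (bound + (n * bound + depth))) , λ u le p →
      start (take depth u) (drop depth u)
        (≤-reflexive (sym (trans (length-take depth u) (m≤n⇒m⊓n≡m (≤-trans (m≤m+n depth _) le)))))
        (≤-trans (≤-reflexive (sym (m+n∸m≡n depth _))) (≤-trans (∸-monoˡ-≤ depth le) (≤-reflexive (sym (length-drop depth u)))))
        (subst P (sym (take++drop≡id depth u)) p)
      where
      m = n * bound + depth
      from-marker : ∀ L x → depth ≤ length L → bound + m ≤ length x → P (L ʳ++ (z ∷ x)) →
        Goal ⊎ (∃[ i ] ∃[ v ] (length v ≡ n × P (σᵢ.σ̂ i v)))
      from-marker L x dL dx p
        with DepthFirst.search-sound alphabet bad _ complete closed bad-sound (λ y → ∃[ i ] Followed i y) some-followed-sound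
               depth true [] (z ∷ []) L x check₂ dL (≤-trans (m≤n+m depth (n * bound)) (≤-trans (m≤n+m m bound) dx)) p
      ... | inj₁ g = inj₁ g
      ... | inj₂ (i , c , x′ , eq)
        with parse i n c L x′ dL (length-block m eq dx) (subst (λ y → P (L ʳ++ y)) eq p)
      ...   | inj₁ g = inj₁ g
      ...   | inj₂ (v , x″ , len , eq′) = inj₂ (i , v , len , closed (reverse L ++ block i c , x″ , (begin
        L ʳ++ (z ∷ x)                                        ≡⟨ cong (L ʳ++_) eq ⟩
        L ʳ++ (block i c ++ z ∷ x′)                          ≡⟨ ʳ++-defn L ⟩
        reverse L ++ block i c ++ z ∷ x′                     ≡⟨ ++-assoc (reverse L) (block i c) (z ∷ x′) ⟨
        (reverse L ++ block i c) ++ z ∷ x′                   ≡⟨ cong ((reverse L ++ block i c) ++_) eq′ ⟩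
        (reverse L ++ block i c) ++ σᵢ.σ i v ++ z ∷ x″       ≡⟨ cong ((reverse L ++ block i c) ++_) (++-assoc (σᵢ.σ i v) (z ∷ []) x″) ⟨
        (reverse L ++ block i c) ++ σᵢ.σ̂ i v ++ x″           ∎)) p)
        where open ≡-Reasoning
      start : ∀ l x → depth ≤ length l → suc depth + (bound + m) ≤ length x → P (l ++ x) →
        Goal ⊎ (∃[ i ] ∃[ v ] (length v ≡ n × P (σᵢ.σ̂ i v)))
      start l x dl dx p
        with DepthFirst.search-sound alphabet bad markerSoon complete closed bad-sound MarkerSoon markerSoon-sound
               depth true [] [] (reverse l) x check₁ (≤-trans dl (≤-reflexive (sym (length-reverse l))))
               (≤-trans (≤-trans (n≤1+n depth) (m≤m+n (suc depth) _)) dx)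
               (subst P (sym (trans (ʳ++-defn (reverse l)) (cong (_++ x) (reverse-involutive l)))) p)
      ... | inj₁ g = inj₁ g
      ... | inj₂ (l′ , x′ , le , refl) = from-marker (l′ ʳ++ reverse l) x′
        (≤-trans (≤-trans dl (≤-reflexive (sym (length-reverse l)))) (≤-trans (m≤n+m _ (length l′)) (≤-reflexive (sym (length-ʳ++ l′)))))
        (+-cancelˡ-≤ (suc depth) _ _ (≤-trans dx (≤-trans (≤-reflexive (length-++ l′))
          (≤-trans (+-monoˡ-≤ (suc (length x′)) le) (≤-reflexive (+-suc depth (length x′)))))))
        (subst P (sym (trans (ʳ++-ʳ++ l′) (trans (ʳ++-defn (reverse l)) (cong (_++ l′ ++ z ∷ x′) (reverse-involutive l))))) p)

-- The codings f, g, h and the verified searches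

f-code : Fin 3 → List Bool
f-code 0F = []
f-code 1F = true ∷ []
f-code 2F = true ∷ true ∷ []

g-code h-code : Fin 3 → Ternary
g-code 0F = 1F ∷ 1F ∷ []
g-code 1F = 1F ∷ 2F ∷ 1F ∷ []
g-code 2F = 1F ∷ 2F ∷ 1F ∷ 2F ∷ 1F ∷ []
h-code 0F = 1F ∷ []
h-code 1F = 2F ∷ []
h-code 2F = 2F ∷ 2F ∷ []

f-coding : Coding false f-code
f-coding = record
  { marker-free     = λ { 0F → [] ; 1F → (λ ()) ∷ [] ; 2F → (λ ()) ∷ (λ ()) ∷ [] }
  ; code-palindrome = λ { 0F → refl ; 1F → refl ; 2F → refl }
  ; code-injective  = λ { 0F 0F _ → refl ; 0F 1F () ; 0F 2F () ; 1F 0F () ; 1F 1F _ → refl ; 1F 2F ()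
                        ; 2F 0F () ; 2F 1F () ; 2F 2F _ → refl }
  }

g-coding : Coding 0F g-code
g-coding = record
  { marker-free     = λ { 0F → (λ ()) ∷ (λ ()) ∷ [] ; 1F → (λ ()) ∷ (λ ()) ∷ (λ ()) ∷ []
                        ; 2F → (λ ()) ∷ (λ ()) ∷ (λ ()) ∷ (λ ()) ∷ (λ ()) ∷ [] }
  ; code-palindrome = λ { 0F → refl ; 1F → refl ; 2F → refl }
  ; code-injective  = λ { 0F 0F _ → refl ; 0F 1F () ; 0F 2F () ; 1F 0F () ; 1F 1F _ → refl ; 1F 2F ()
                        ; 2F 0F () ; 2F 1F () ; 2F 2F _ → refl }
  }

h-coding : Coding 0F h-code
h-coding = record
  { marker-free     = λ { 0F → (λ ()) ∷ [] ; 1F → (λ ()) ∷ [] ; 2F → (λ ()) ∷ (λ ()) ∷ [] }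
  ; code-palindrome = λ { 0F → refl ; 1F → refl ; 2F → refl }
  ; code-injective  = λ { 0F 0F _ → refl ; 0F 1F () ; 0F 2F () ; 1F 0F () ; 1F 1F _ → refl ; 1F 2F ()
                        ; 2F 0F () ; 2F 1F () ; 2F 2F _ → refl }
  }

open Coding f-coding public using () renaming (σ to f; σ̂ to f̂)
open Coding g-coding public using () renaming (σ to g; σ̂ to ĝ)
open Coding h-coding public using () renaming (σ to h; σ̂ to ĥ)

module Binary = Patterns _≟B_
module Tern = Patterns {Fin 3} _≟F_

booleans : List Bool
booleans = false ∷ true ∷ []

-- The overlap that makes a repetition of period p an 11/4-power; p / 4 is rounded down.
elevenFourths : ℕ → ℕ
elevenFourths p = 2 * p ∸ p / 4

-- The overlap that makes a repetition of period p a cube.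
twice : ℕ → ℕ
twice p = 2 * p

-- The periods in the tests below were found by computer.  The depth 26 is enough for every search.
bad₀ : List Bool → Bool
bad₀ = Binary.hasPower elevenFourths (1 ∷ [])

periods-f : List ℕ
periods-f = 1 ∷ 2 ∷ 3 ∷ 4 ∷ 5 ∷ 7 ∷ 9 ∷ 15 ∷ 16 ∷ []

-- A ternary letter adds at most three binary letters, so four suffixes from either end cover one
-- extension.
bad₁ : Ternary → Bool
bad₁ u = Binary.hasPower elevenFourths periods-f (f̂ u) ∨ Binary.defective 4 (f̂ u)

badImage : (Ternary → List Bool) → List ℕ → Ternary → Bool
badImage φ ps u = Binary.hasPower elevenFourths ps (φ u) ∨ Tern.defective 2 u

-- The first five lists are the lengths of the images of 0, 1, 2, 12 and 122 under the composed
-- coding; the last one holds the lengths of h³ of 0, 1, 2, 01, 12 and 0112.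
periods-fh periods-fhh periods-fg periods-fgh periods-fghh periods-hhh : List ℕ
periods-fh   = 3 ∷ 4 ∷ 7 ∷ 11 ∷ 18 ∷ []
periods-fhh  = 7 ∷ 10 ∷ 17 ∷ 27 ∷ 44 ∷ []
periods-fg   = 5 ∷ 8 ∷ 13 ∷ 21 ∷ 34 ∷ []
periods-fgh  = 13 ∷ 18 ∷ 31 ∷ 49 ∷ 80 ∷ []
periods-fghh = 31 ∷ 44 ∷ 75 ∷ 119 ∷ 194 ∷ []
periods-hhh  = 9 ∷ 12 ∷ 20 ∷ 21 ∷ 32 ∷ 53 ∷ []

-- h³(0) = 010201022 is a prefix of h³(1), which is a prefix of h³(2). So h³(00c), for instance,
-- starts with a cube for every letter c: looking for cubes after three applications of h excludes
-- more than the cubes of u itself.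
badDeep : Ternary → Bool
badDeep u = Tern.hasPower twice periods-hhh (ĥ (ĥ (ĥ u))) ∨ Tern.defective 2 u

gh-code : Bool → Fin 3 → Ternary
gh-code false = g-code
gh-code true  = h-code

module Parse₀ = Parsing _≟B_ booleans false (tt ∷ []) (λ _ → f-code) bad₀ 26
module Parse₁ = Parsing {Fin 3} _≟F_ letters₃ 0F booleans gh-code bad₁ 26
module ParseImage (φ : Ternary → List Bool) (ps : List ℕ) = Parsing {Fin 3} _≟F_ letters₃ 0F (tt ∷ []) (λ _ → h-code) (badImage φ ps) 26
module ParseDeep = Parsing {Fin 3} _≟F_ letters₃ 0F (tt ∷ []) (λ _ → h-code) badDeep 26

checked₀ : Parse₀.Verified
checked₀ = record { parses-true = refl }

checked₁ : Parse₁.Verified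
checked₁ = record { parses-true = refl }

checked-fh : ParseImage.Verified (f̂ ∘ ĥ) periods-fh
checked-fh = record { parses-true = refl }

checked-fhh : ParseImage.Verified (f̂ ∘ ĥ ∘ ĥ) periods-fhh
checked-fhh = record { parses-true = refl }

checked-fg : ParseImage.Verified (f̂ ∘ ĝ) periods-fg
checked-fg = record { parses-true = refl }

checked-fgh : ParseImage.Verified (f̂ ∘ ĝ ∘ ĥ) periods-fgh
checked-fgh = record { parses-true = refl }

checked-fghh : ParseImage.Verified (f̂ ∘ ĝ ∘ ĥ ∘ ĥ) periods-fghh
checked-fghh = record { parses-true = refl }

checked-deep : ParseDeep.Verified
checked-deep = record { parses-true = refl }

-- Repetitions of exponent close to 2 + √2/2

occurs-lookup : ∀ w i j u → Occurs w i u → Occurs w j u → ∀ k → k < length u → w (i + k) ≡ w (j + k)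
occurs-lookup w i j (c ∷ u) (e , _) (e′ , _) zero    _        =
  trans (cong w (+-identityʳ i)) (trans e (sym (trans (cong w (+-identityʳ j)) e′)))
occurs-lookup w i j (c ∷ u) (_ , o) (_ , o′) (suc k) (s≤s lt) =
  trans (cong w (+-suc i k)) (trans (occurs-lookup w (suc i) (suc j) u o o′ k lt) (cong w (sym (+-suc j k))))

occurs-drop : ∀ w i p u → Occurs w i u → Occurs w (i + p) (drop p u)
occurs-drop w i zero    u       o       = subst (λ j → Occurs w j u) (sym (+-identityʳ i)) o
occurs-drop w i (suc p) []      o       = tt
occurs-drop w i (suc p) (c ∷ u) (_ , o) = subst (λ j → Occurs w j (drop p u)) (sym (+-suc i p)) (occurs-drop w (suc i) p u o)

-- Between two letters 0, the word x = lead 2 border is carried by h² to 2 h²(x) 0102, again a repetition, whose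
-- period has the length of h²(lead 2).
record Repetition : Set where
  constructor repetition
  field
    lead border trail : Ternary
    bordered : lead ++ 2F ∷ border ≡ border ++ 2F ∷ trail

open Repetition

whole : Repetition → Ternary
whole r = lead r ++ 2F ∷ border r

h² : Ternary → Ternary
h² u = h (h u)

h²-++ : ∀ u v → h² (u ++ v) ≡ h² u ++ h² v
h²-++ u v = trans (cong h (Coding.σ-++ h-coding u v)) (Coding.σ-++ h-coding (h u) (h v))

w0102 : Ternary
w0102 = 0F ∷ 1F ∷ 0F ∷ 2F ∷ []

lift : Repetition → Repetition
-- h²(2) = 01022022 is cut before its last two letters: the first of them is the marked 2, the
-- second opens the new border.
lift (repetition s o e eq) = repetition (2F ∷ h² s ++ w0102 ++ 2F ∷ 0F ∷ []) (2F ∷ h² o ++ w0102) (0F ∷ 2F ∷ 2F ∷ h² e ++ w0102) (begin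
  (2F ∷ h² s ++ w0102 ++ 2F ∷ 0F ∷ []) ++ 2F ∷ 2F ∷ h² o ++ w0102
    ≡⟨ cong (2F ∷_) (++-assoc (h² s) _ _) ⟩
  2F ∷ h² s ++ h² (2F ∷ o) ++ w0102       ≡⟨ cong (2F ∷_) (++-assoc (h² s) (h² (2F ∷ o)) w0102) ⟨
  2F ∷ (h² s ++ h² (2F ∷ o)) ++ w0102     ≡⟨ cong (λ x → 2F ∷ x ++ w0102) (h²-++ s (2F ∷ o)) ⟨
  2F ∷ h² (s ++ 2F ∷ o) ++ w0102          ≡⟨ cong (λ x → 2F ∷ h² x ++ w0102) eq ⟩
  2F ∷ h² (o ++ 2F ∷ e) ++ w0102          ≡⟨ cong (λ x → 2F ∷ x ++ w0102) (h²-++ o (2F ∷ e)) ⟩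
  2F ∷ (h² o ++ h² (2F ∷ e)) ++ w0102     ≡⟨ cong (2F ∷_) (++-assoc (h² o) (h² (2F ∷ e)) w0102) ⟩
  2F ∷ h² o ++ h² (2F ∷ e) ++ w0102       ≡⟨ cong (2F ∷_) (++-assoc (h² o) w0102 _) ⟨
  (2F ∷ h² o ++ w0102) ++ 2F ∷ 0F ∷ 2F ∷ 2F ∷ h² e ++ w0102  ∎)
  where open ≡-Reasoning

lifts : ℕ → Repetition
lifts zero    = repetition [] (2F ∷ []) [] refl
lifts (suc j) = lift (lifts j)

flanked : Ternary → Ternary
flanked u = 0F ∷ u ++ 0F ∷ []

whole-lift : ∀ r → whole (lift r) ≡ 2F ∷ h² (whole r) ++ w0102
whole-lift (repetition s o e eq) = cong (2F ∷_) (begin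
  (h² s ++ w0102 ++ 2F ∷ 0F ∷ []) ++ 2F ∷ 2F ∷ h² o ++ w0102 ≡⟨ ++-assoc (h² s) _ _ ⟩
  h² s ++ h² (2F ∷ o) ++ w0102       ≡⟨ ++-assoc (h² s) (h² (2F ∷ o)) w0102 ⟨
  (h² s ++ h² (2F ∷ o)) ++ w0102     ≡⟨ cong (_++ w0102) (h²-++ s (2F ∷ o)) ⟨
  h² (s ++ 2F ∷ o) ++ w0102          ∎)
  where open ≡-Reasoning

-- The images 0102 of the flanking letters supply the 2 in front and the 0102 behind, and the
-- letters 0 next to these flank the result again.
flanked-lift : ∀ r → Infix (flanked (whole (lift r))) (ĥ (ĥ (flanked (whole r))))
flanked-lift r = 0F ∷ 1F ∷ [] , 1F ∷ 0F ∷ [] , sym (begin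
  0F ∷ 1F ∷ flanked (whole (lift r)) ++ 1F ∷ 0F ∷ []
    ≡⟨ cong (λ x → 0F ∷ 1F ∷ flanked x ++ 1F ∷ 0F ∷ []) (whole-lift r) ⟩
  0F ∷ 1F ∷ 0F ∷ 2F ∷ ((h² x ++ w0102) ++ 0F ∷ []) ++ 1F ∷ 0F ∷ []
    ≡⟨ cong (λ y → 0F ∷ 1F ∷ 0F ∷ 2F ∷ y) (trans (++-assoc (h² x ++ w0102) (0F ∷ []) _) (++-assoc (h² x) w0102 _)) ⟩
  0F ∷ 1F ∷ 0F ∷ 2F ∷ h² x ++ w0102 ++ 0F ∷ 1F ∷ 0F ∷ []
    ≡⟨ cong (λ y → 0F ∷ 1F ∷ 0F ∷ 2F ∷ y) (++-assoc (h² x) (w0102 ++ 0F ∷ 1F ∷ []) (0F ∷ [])) ⟨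
  0F ∷ 1F ∷ 0F ∷ 2F ∷ (h² x ++ h (0F ∷ 1F ∷ 0F ∷ [])) ++ 0F ∷ []
    ≡⟨ cong (λ y → 0F ∷ 1F ∷ 0F ∷ 2F ∷ y ++ 0F ∷ []) (Coding.σ-++ h-coding (h x) (0F ∷ 1F ∷ 0F ∷ [])) ⟨
  0F ∷ 1F ∷ 0F ∷ 2F ∷ h (h x ++ h (0F ∷ []) ++ 0F ∷ []) ++ 0F ∷ []
    ≡⟨ cong (λ y → ĥ (0F ∷ 1F ∷ y)) (trans (sym (++-assoc (h x) (h (0F ∷ [])) (0F ∷ []))) (cong (_++ 0F ∷ []) (sym (Coding.σ-++ h-coding x (0F ∷ []))))) ⟩
  ĥ (ĥ (flanked x)) ∎)
  where
  open ≡-Reasoning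
  x = whole r

-- Under f and under f g the image of 2 is as long as those of 0 and 1 together, and h² preserves
-- this relation, so two weights describe all lengths.
weight₃ : ℕ → ℕ → Ternary → ℕ
weight₃ p q []       = 0
weight₃ p q (0F ∷ u) = p + weight₃ p q u
weight₃ p q (1F ∷ u) = q + weight₃ p q u
weight₃ p q (2F ∷ u) = (p + q) + weight₃ p q u

weight₃-++ : ∀ p q u v → weight₃ p q (u ++ v) ≡ weight₃ p q u + weight₃ p q v
weight₃-++ p q []       v = refl
weight₃-++ p q (0F ∷ u) v = trans (cong (p +_) (weight₃-++ p q u v)) (sym (+-assoc p _ _))
weight₃-++ p q (1F ∷ u) v = trans (cong (q +_) (weight₃-++ p q u v)) (sym (+-assoc q _ _))
weight₃-++ p q (2F ∷ u) v = trans (cong (p + q +_) (weight₃-++ p q u v)) (sym (+-assoc (p + q) _ _))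

weight₃-h² : ∀ p q u → weight₃ p q (h² u) ≡ weight₃ (3 * p + 2 * q) (4 * p + 3 * q) u
weight₃-h² p q []       = refl
weight₃-h² p q (0F ∷ u) = trans (lem p q _) (cong (3 * p + 2 * q +_) (weight₃-h² p q u))
  where lem : ∀ p q x → p + (q + (p + ((p + q) + x))) ≡ 3 * p + 2 * q + x
        lem = solve-∀
weight₃-h² p q (1F ∷ u) = trans (lem p q _) (cong (4 * p + 3 * q +_) (weight₃-h² p q u))
  where lem : ∀ p q x → p + (q + (p + ((p + q) + ((p + q) + x)))) ≡ 4 * p + 3 * q + x
        lem = solve-∀
weight₃-h² p q (2F ∷ u) = trans (lem p q _) (cong (3 * p + 2 * q + (4 * p + 3 * q) +_) (weight₃-h² p q u))
  where lem : ∀ p q x → p + (q + (p + ((p + q) + ((p + q) + (p + ((p + q) + ((p + q) + x))))))) ≡ 3 * p + 2 * q + (4 * p + 3 * q) + x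
        lem = solve-∀

length-f : ∀ u → length (f u) ≡ weight₃ 1 2 u
length-f []       = refl
length-f (0F ∷ u) = cong (1 +_) (length-f u)
length-f (1F ∷ u) = cong (2 +_) (length-f u)
length-f (2F ∷ u) = cong (3 +_) (length-f u)

length-fg : ∀ u → length (f (g u)) ≡ weight₃ 5 8 u
length-fg []       = refl
length-fg (0F ∷ u) = cong (5 +_) (length-fg u)
length-fg (1F ∷ u) = cong (8 +_) (length-fg u)
length-fg (2F ∷ u) = cong (13 +_) (length-fg u)

-- The weights that weight₃ p q induces on the letters 0 and 1 after j applications of h².
scaled : ℕ → ℕ → ℕ → ℕ × ℕ
scaled zero    p q = p , q
scaled (suc j) p q = scaled j (3 * p + 2 * q) (4 * p + 3 * q)

period-weight : ∀ j p q → weight₃ p q (lead (lifts j)) + (p + q) ≡ proj₁ (scaled j p q) + proj₂ (scaled j p q)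
period-weight zero    p q = refl
period-weight (suc j) p q = trans (begin
  (p + q) + weight₃ p q (h² s ++ w0102 ++ 2F ∷ 0F ∷ []) + (p + q) ≡⟨ cong (λ x → (p + q) + x + (p + q)) (weight₃-++ p q (h² s) _) ⟩
  (p + q) + (weight₃ p q (h² s) + weight₃ p q (w0102 ++ 2F ∷ 0F ∷ [])) + (p + q) ≡⟨ cong (λ x → (p + q) + (x + weight₃ p q (w0102 ++ 2F ∷ 0F ∷ [])) + (p + q)) (weight₃-h² p q s) ⟩
  (p + q) + (weight₃ p′ q′ s + weight₃ p q (w0102 ++ 2F ∷ 0F ∷ [])) + (p + q) ≡⟨ lem p q (weight₃ p′ q′ s) ⟩
  weight₃ p′ q′ s + (p′ + q′) ∎) (period-weight j p′ q′)
  where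
  open ≡-Reasoning
  s = lead (lifts j)
  p′ = 3 * p + 2 * q
  q′ = 4 * p + 3 * q
  lem : ∀ p q x → (p + q) + (x + (p + (q + (p + ((p + q) + ((p + q) + (p + 0))))))) + (p + q) ≡ x + (3 * p + 2 * q + (4 * p + 3 * q))
  lem = solve-∀

-- With (P, Q) = `scaled j p q` and Q/P tending to √2, overlap divided by period tends to (4 +
-- 3√2)/(2 + 2√2) = 1 + √2/2; only the constant 2p + q is lost.
border-weight : ∀ j p q → 2 * weight₃ p q (border (lifts j)) + (2 * p + q) ≡ 4 * proj₁ (scaled j p q) + 3 * proj₂ (scaled j p q)
border-weight zero    p q = lem p q
  where lem : ∀ p q → 2 * (p + q + 0) + (2 * p + q) ≡ 4 * p + 3 * q
        lem = solve-∀
border-weight (suc j) p q = trans (begin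
  2 * ((p + q) + weight₃ p q (h² o ++ w0102)) + (2 * p + q) ≡⟨ cong (λ x → 2 * ((p + q) + x) + (2 * p + q)) (weight₃-++ p q (h² o) w0102) ⟩
  2 * ((p + q) + (weight₃ p q (h² o) + weight₃ p q w0102)) + (2 * p + q) ≡⟨ cong (λ x → 2 * ((p + q) + (x + weight₃ p q w0102)) + (2 * p + q)) (weight₃-h² p q o) ⟩
  2 * ((p + q) + (weight₃ p′ q′ o + weight₃ p q w0102)) + (2 * p + q) ≡⟨ lem p q (weight₃ p′ q′ o) ⟩
  2 * weight₃ p′ q′ o + (2 * p′ + q′) ∎) (border-weight j p′ q′)
  where
  open ≡-Reasoning
  o = border (lifts j)
  p′ = 3 * p + 2 * q
  q′ = 4 * p + 3 * q
  lem : ∀ p q x → 2 * ((p + q) + (x + (p + (q + (p + ((p + q) + 0)))))) + (2 * p + q) ≡ 2 * x + (2 * (3 * p + 2 * q) + (4 * p + 3 * q))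
  lem = solve-∀

-- On weights h² acts as the square of the Pell step, so it preserves q² - 2p².
scaled-norm : ∀ j p q D → q * q ≡ 2 * (p * p) + D → q ≤ 2 * p →
  proj₂ (scaled j p q) * proj₂ (scaled j p q) ≡ 2 * (proj₁ (scaled j p q) * proj₁ (scaled j p q)) + D ×
  proj₂ (scaled j p q) ≤ 2 * proj₁ (scaled j p q)
scaled-norm zero    p q D eq le = eq , le
scaled-norm (suc j) p q D eq le = scaled-norm j _ _ D
  (+-cancelʳ-≡ (2 * (p * p)) _ _ (begin
    (4 * p + 3 * q) * (4 * p + 3 * q) + 2 * (p * p)                 ≡⟨ lem₁ p q ⟩
    2 * ((3 * p + 2 * q) * (3 * p + 2 * q)) + q * q                 ≡⟨ cong (2 * ((3 * p + 2 * q) * (3 * p + 2 * q)) +_) (trans eq (+-comm (2 * (p * p)) D)) ⟩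
    2 * ((3 * p + 2 * q) * (3 * p + 2 * q)) + (D + 2 * (p * p))     ≡⟨ +-assoc (2 * ((3 * p + 2 * q) * (3 * p + 2 * q))) D (2 * (p * p)) ⟨
    2 * ((3 * p + 2 * q) * (3 * p + 2 * q)) + D + 2 * (p * p)       ∎))
  (≤-trans (m≤m+n _ (2 * p + q)) (≤-reflexive (lem₂ p q)))
  where
  open ≡-Reasoning
  lem₁ : ∀ p q → (4 * p + 3 * q) * (4 * p + 3 * q) + 2 * (p * p) ≡ 2 * ((3 * p + 2 * q) * (3 * p + 2 * q)) + q * q
  lem₁ = solve-∀
  lem₂ : ∀ p q → 4 * p + 3 * q + (2 * p + q) ≡ 2 * (3 * p + 2 * q)
  lem₂ = solve-∀

scaled-grows : ∀ j p q → 0 < p → p + j ≤ proj₁ (scaled j p q)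
scaled-grows zero    p q p>0 = ≤-reflexive (+-identityʳ p)
scaled-grows (suc j) p q p>0 = begin
  p + suc j                     ≡⟨ +-suc p j ⟩
  suc p + j                     ≤⟨ +-monoˡ-≤ j (+-monoˡ-≤ p p>0) ⟩
  p + p + j                     ≤⟨ m≤m+n _ (p + 2 * q) ⟩
  p + p + j + (p + 2 * q)       ≡⟨ lem p q j ⟩
  3 * p + 2 * q + j             ≤⟨ scaled-grows j _ _ (≤-trans p>0 (≤-trans (m≤m+n p _) (m≤m+n _ (2 * q)))) ⟩
  proj₁ (scaled (suc j) p q)    ∎
  where
  open ≤-Reasoning
  lem : ∀ p q j → p + p + j + (p + 2 * q) ≡ 3 * p + 2 * q + j
  lem = solve-∀

-- If 2 a = 5 b + d and b = d + s, then a / b < 2 + √2/2 reads 2 d² < s², and q / p tends to √2.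
limit-reached-above : ∀ b d s p q C D → d + s ≡ b → q * q ≡ 2 * (p * p) + D → q ≤ 2 * p →
  b * b * (D + 4 * C + C * C) + C < p → 2 * (d * d) < s * s → d * q + b * C ≤ s * p
limit-reached-above b d s p q C D refl norm q≤2p large 2d²<s² with ≤-total (d * q + b * C) (s * p)
... | inj₁ le = le
... | inj₂ ge = ⊥-elim (<⇒≱ large (≤-trans (*-cancelʳ-≤ p _ p {{>-nonZero p>0}} square) (m≤m+n _ C)))
  where
  open ≤-Reasoning
  K = D + 4 * C + C * C
  d≤b : d ≤ b
  d≤b = m≤m+n d s
  p>0 : 0 < p
  p>0 = ≤-trans (s≤s z≤n) large
  m≤m*p : ∀ m → m ≤ m * p
  m≤m*p m = ≤-trans (≤-reflexive (sym (*-identityʳ m))) (*-monoʳ-≤ m p>0)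
  lem₁ : ∀ s p → s * s * (p * p) ≡ (s * p) * (s * p)
  lem₁ = solve-∀
  lem₂ : ∀ d q b C → (d * q + b * C) * (d * q + b * C) ≡ d * d * (q * q) + (2 * (d * (b * C)) * q + b * b * (C * C))
  lem₂ = solve-∀
  lem₃ : ∀ d p D x → d * d * (2 * (p * p) + D) + x ≡ d * d * D + x + 2 * (d * d) * (p * p)
  lem₃ = solve-∀
  lem₄ : ∀ b C D p → b * b * D * p + (2 * (b * (b * C)) * (2 * p) + b * b * (C * C) * p) ≡ b * b * (D + 4 * C + C * C) * p
  lem₄ = solve-∀
  square : p * p ≤ b * b * K * p
  square = +-cancelʳ-≤ (2 * (d * d) * (p * p)) _ _ (begin
    -- Since 2d² + 1 ≤ s², one p² is left over, while the remaining terms are at most linear in p.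
    p * p + 2 * (d * d) * (p * p)          ≤⟨ *-monoˡ-≤ (p * p) 2d²<s² ⟩
    s * s * (p * p)                        ≡⟨ lem₁ s p ⟩
    (s * p) * (s * p)                      ≤⟨ *-mono-≤ ge ge ⟩
    (d * q + b * C) * (d * q + b * C)      ≡⟨ lem₂ d q b C ⟩
    d * d * (q * q) + (2 * (d * (b * C)) * q + b * b * (C * C))
      ≡⟨ cong (λ x → d * d * x + (2 * (d * (b * C)) * q + b * b * (C * C))) norm ⟩
    d * d * (2 * (p * p) + D) + (2 * (d * (b * C)) * q + b * b * (C * C)) ≡⟨ lem₃ d p D _ ⟩
    d * d * D + (2 * (d * (b * C)) * q + b * b * (C * C)) + 2 * (d * d) * (p * p)
      ≤⟨ +-monoˡ-≤ (2 * (d * d) * (p * p)) (+-mono-≤ (≤-trans (*-monoˡ-≤ D (*-mono-≤ d≤b d≤b)) (m≤m*p _))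
           (+-mono-≤ (*-mono-≤ (*-monoʳ-≤ 2 (*-monoˡ-≤ (b * C) d≤b)) q≤2p) (m≤m*p (b * b * (C * C))))) ⟩
    b * b * D * p + (2 * (b * (b * C)) * (2 * p) + b * b * (C * C) * p) + 2 * (d * d) * (p * p)
      ≡⟨ cong (_+ 2 * (d * d) * (p * p)) (lem₄ b C D p) ⟩
    b * b * K * p + 2 * (d * d) * (p * p)  ∎)

-- Exponents below the threshold

module _ (a b : ℕ) (b>0 : 0 < b) (b<a : b < a) (small : (2 * a ∸ 4 * b) ^ 2 < 2 * (b * b)) where

  private
    e : ℕ
    e = 2 * a ∸ 4 * b

    small′ : e * e < 2 * (b * b)
    small′ = subst (_< 2 * (b * b)) (cong (e *_) (*-identityʳ e)) small

    -- Only an inequality, because `e` is cut off at 0 when a < 2b.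
    2a≤e+4b : 2 * a ≤ e + 4 * b
    2a≤e+4b = ≤-trans (m≤n+m∸n (2 * a) (4 * b)) (≤-reflexive (+-comm (4 * b) e))

    -- From (3/2)² > 2; this is where 2 + √2/2 < 11/4 enters.
    2e≤3b : 2 * e ≤ 3 * b
    2e≤3b with ≤-total (2 * e) (3 * b)
    ... | inj₁ le = le
    ... | inj₂ ge = ⊥-elim (<⇒≱ small′ (*-cancelˡ-≤ 4 (begin
      4 * (2 * (b * b))    ≤⟨ m≤m+n _ (b * b) ⟩
      4 * (2 * (b * b)) + b * b ≡⟨ lem₁ b ⟩
      (3 * b) * (3 * b)    ≤⟨ *-mono-≤ ge ge ⟩
      (2 * e) * (2 * e)    ≡⟨ lem₂ e ⟩
      4 * (e * e)          ∎)))
      where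
      open ≤-Reasoning
      lem₁ : ∀ b → 4 * (2 * (b * b)) + b * b ≡ (3 * b) * (3 * b)
      lem₁ = solve-∀
      lem₂ : ∀ e → (2 * e) * (2 * e) ≡ 4 * (e * e)
      lem₂ = solve-∀

    4a≤11b : 4 * a ≤ 11 * b
    4a≤11b = begin
      4 * a              ≡⟨ *-assoc 2 2 a ⟩
      2 * (2 * a)        ≤⟨ *-monoʳ-≤ 2 2a≤e+4b ⟩
      2 * (e + 4 * b)    ≡⟨ lem e b ⟩
      2 * e + 8 * b      ≤⟨ +-monoˡ-≤ (8 * b) 2e≤3b ⟩
      3 * b + 8 * b      ≡⟨ *-distribʳ-+ b 3 8 ⟨
      11 * b             ∎
      where
      open ≤-Reasoning
      lem : ∀ e b → 2 * (e + 4 * b) ≡ 2 * e + 8 * b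
      lem = solve-∀

  elevenFourths-exceeds : ∀ p → a * p ≤ (p + elevenFourths p) * b
  elevenFourths-exceeds p = *-cancelˡ-≤ 4 (+-cancelʳ-≤ (p * b) _ _ (begin
    4 * (a * p) + p * b                         ≡⟨ cong (_+ p * b) (*-assoc 4 a p) ⟨
    4 * a * p + p * b                           ≤⟨ +-monoˡ-≤ (p * b) (*-monoˡ-≤ p 4a≤11b) ⟩
    11 * b * p + p * b                          ≡⟨ lem₁ b p ⟩
    4 * ((p + 2 * p) * b)                       ≤⟨ *-monoʳ-≤ 4 (*-monoˡ-≤ b (+-monoʳ-≤ p (m≤n+m∸n (2 * p) (p / 4)))) ⟩
    4 * ((p + (p / 4 + elevenFourths p)) * b)   ≡⟨ lem₂ p b (p / 4) (elevenFourths p) ⟩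
    4 * ((p + elevenFourths p) * b) + p / 4 * 4 * b ≤⟨ +-monoʳ-≤ _ (*-monoˡ-≤ b (m/n*n≤m p 4)) ⟩
    4 * ((p + elevenFourths p) * b) + p * b     ∎))
    where
    open ≤-Reasoning
    lem₁ : ∀ b p → 11 * b * p + p * b ≡ 4 * ((p + 2 * p) * b)
    lem₁ = solve-∀
    lem₂ : ∀ p b x y → 4 * ((p + (x + y)) * b) ≡ 4 * ((p + y) * b) + x * 4 * b
    lem₂ = solve-∀

  -- Twice the inequality for a repetition of period p + q and overlap (4p + 3q - C)/2. For 2a ≤ 5b
  -- there is room to spare; otherwise d = 2a - 5b brings it to the form of `limit-reached-above`.
  limit-reached : ∀ p q C D → q * q ≡ 2 * (p * p) + D → q ≤ 2 * p →
    b * b * (D + 4 * C + C * C) + C < p → 2 * a * (p + q) + b * C ≤ b * (6 * p + 5 * q)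
  limit-reached p q C D norm q≤2p large with ≤-total (2 * a) (5 * b)
  ... | inj₁ 2a≤5b = begin
    2 * a * (p + q) + b * C     ≤⟨ +-mono-≤ (*-monoˡ-≤ (p + q) 2a≤5b) (*-monoʳ-≤ b (≤-trans (m≤n+m C _) (<⇒≤ large))) ⟩
    5 * b * (p + q) + b * p     ≡⟨ lem b p q ⟩
    b * (6 * p + 5 * q)         ∎
    where
    open ≤-Reasoning
    lem : ∀ b p q → 5 * b * (p + q) + b * p ≡ b * (6 * p + 5 * q)
    lem = solve-∀
  ... | inj₂ 5b≤2a with m≤n⇒∃[o]m+o≡n 5b≤2a
  ...   | d , 5b+d≡2a = begin
    2 * a * (p + q) + b * C                       ≡⟨ cong (λ x → x * (p + q) + b * C) 5b+d≡2a ⟨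
    (5 * b + d) * (p + q) + b * C                 ≡⟨ lem₁ b d p q (b * C) ⟩
    5 * b * (p + q) + d * p + (d * q + b * C)     ≤⟨ +-monoʳ-≤ (5 * b * (p + q) + d * p) (limit-reached-above b d s p q C D d+s≡b norm q≤2p large 2d²<s²) ⟩
    5 * b * (p + q) + d * p + s * p               ≡⟨ lem₂ (5 * b * (p + q)) d s p ⟩
    5 * b * (p + q) + (d + s) * p                 ≡⟨ cong (λ x → 5 * b * (p + q) + x * p) d+s≡b ⟩
    5 * b * (p + q) + b * p                       ≡⟨ lem₃ b p q ⟩
    b * (6 * p + 5 * q)                           ∎
    where
    open ≤-Reasoning
    e≡b+d : e ≡ b + d
    e≡b+d = trans (cong (_∸ 4 * b) (trans (sym 5b+d≡2a) (lem b d))) (m+n∸n≡m (b + d) (4 * b))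
      where lem : ∀ b d → 5 * b + d ≡ b + d + 4 * b
            lem = solve-∀
    d≤b : d ≤ b
    d≤b = *-cancelˡ-≤ 2 (+-cancelˡ-≤ (2 * b) _ _ (begin
      2 * b + 2 * d    ≡⟨ *-distribˡ-+ 2 b d ⟨
      2 * (b + d)      ≡⟨ cong (2 *_) e≡b+d ⟨
      2 * e            ≤⟨ 2e≤3b ⟩
      3 * b            ≤⟨ m≤m+n (3 * b) b ⟩
      3 * b + b        ≡⟨ lem b ⟩
      2 * b + 2 * b    ∎))
      where
      lem : ∀ b → 3 * b + b ≡ 2 * b + 2 * b
      lem = solve-∀
    s : ℕ
    s = b ∸ d
    d+s≡b : d + s ≡ b
    d+s≡b = m+[n∸m]≡n d≤b
    2d²<s² : 2 * (d * d) < s * s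
    2d²<s² = +-cancelʳ-< (s * s + 4 * (s * d) + 2 * (d * d)) _ _
      (subst₂ _<_ (trans (cong (λ x → x * x) (trans e≡b+d (cong (_+ d) (sym d+s≡b)))) (lem-e s d))
                  (trans (cong (λ x → 2 * (x * x)) (sym d+s≡b)) (lem-b s d)) small′)
      where
      lem-e : ∀ s d → (d + s + d) * (d + s + d) ≡ 2 * (d * d) + (s * s + 4 * (s * d) + 2 * (d * d))
      lem-e = solve-∀
      lem-b : ∀ s d → 2 * ((d + s) * (d + s)) ≡ s * s + (s * s + 4 * (s * d) + 2 * (d * d))
      lem-b = solve-∀
    lem₁ : ∀ b d p q x → (5 * b + d) * (p + q) + x ≡ 5 * b * (p + q) + d * p + (d * q + x)
    lem₁ = solve-∀
    lem₂ : ∀ x d s p → x + d * p + s * p ≡ x + (d + s) * p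
    lem₂ = solve-∀
    lem₃ : ∀ b p q → 5 * b * (p + q) + b * p ≡ b * (6 * p + 5 * q)
    lem₃ = solve-∀

++-injective : ∀ {A : Set} (x y : List A) {s t} → length x ≡ length y → x ++ s ≡ y ++ t → x ≡ y × s ≡ t
++-injective []      []      _   eq = refl , eq
++-injective (a ∷ x) (b ∷ y) len eq with ∷-injective eq
... | refl , eq′ with ++-injective x y (suc-injective len) eq′
...   | refl , e = refl , e

cube-prefix : ∀ {A : Set} p (s y : List A) {r r′} → length y ≡ 2 * suc p → s ≡ y ++ r → drop (suc p) s ≡ y ++ r′ →
  ∃[ v ] (v ≢ [] × Infix (v ++ v ++ v) s)
cube-prefix p s y {r} {r′} len eq eq′ = v , nonempty , ([] , r′ , cubes)
  where
  n = suc p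
  v = take n y
  x = drop n y
  2n≡ : length y ≡ n + n
  2n≡ = trans len (cong (n +_) (+-identityʳ n))
  len-v : length v ≡ n
  len-v = trans (length-take n y) (m≤n⇒m⊓n≡m (≤-trans (m≤m+n n n) (≤-reflexive (sym 2n≡))))
  len-x : length x ≡ n
  len-x = trans (length-drop n y) (trans (cong (_∸ n) 2n≡) (m+n∸n≡m n n))
  nonempty : v ≢ []
  nonempty e with () ← trans (sym len-v) (cong length e)
  y≡ : y ≡ v ++ x
  y≡ = sym (take++drop≡id n y)
  s≡ : s ≡ v ++ x ++ r
  s≡ = trans eq (trans (cong (_++ r) y≡) (++-assoc v x r))
  drop-v : ∀ u (t : List _) → length u ≡ n → drop n (u ++ t) ≡ t
  drop-v u t e = trans (cong (λ m → drop m (u ++ t)) (sym e)) (drop-length u t)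
    where
    drop-length : ∀ {A : Set} (u t : List A) → drop (length u) (u ++ t) ≡ t
    drop-length []      t = refl
    drop-length (_ ∷ u) t = drop-length u t
  shifted : x ++ r ≡ v ++ x ++ r′
  shifted = begin
    x ++ r                ≡⟨ drop-v v (x ++ r) len-v ⟨
    drop n (v ++ x ++ r)  ≡⟨ cong (drop n) s≡ ⟨
    drop n s              ≡⟨ eq′ ⟩
    y ++ r′               ≡⟨ cong (_++ r′) y≡ ⟩
    (v ++ x) ++ r′        ≡⟨ ++-assoc v x r′ ⟩
    v ++ x ++ r′          ∎
    where open ≡-Reasoning
  x≡v : x ≡ v
  x≡v = proj₁ (++-injective x v (trans len-x (sym len-v)) shifted)
  cubes : s ≡ (v ++ v ++ v) ++ r′
  cubes = begin
    s                     ≡⟨ s≡ ⟩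
    v ++ x ++ r           ≡⟨ cong (v ++_) shifted ⟩
    v ++ v ++ x ++ r′     ≡⟨ cong (λ t → v ++ v ++ t ++ r′) x≡v ⟩
    v ++ v ++ v ++ r′     ≡⟨ cong (v ++_) (++-assoc v v r′) ⟨
    v ++ (v ++ v) ++ r′   ≡⟨ ++-assoc v (v ++ v) r′ ⟨
    (v ++ v ++ v) ++ r′   ∎
    where open ≡-Reasoning

double : ℕ → ℕ
double zero    = zero
double (suc j) = suc (suc (double j))

underĥ : ℕ → (Ternary → Set) → Ternary → Set
underĥ zero    P = P
underĥ (suc k) P = underĥ k (P ∘ ĥ)

⊤-complete : ∀ (i : ⊤) → i ∈ (tt ∷ [])
⊤-complete tt = here refl

booleans-complete : ∀ b → b ∈ booleans
booleans-complete false = here refl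
booleans-complete true  = there (here refl)

-- Descent through the preimages of a rich word

module _ (a b : ℕ) (b>0 : 0 < b) (b<a : b < a) (small : (2 * a ∸ 4 * b) ^ 2 < 2 * (b * b))
         (w : InfWord) (rich : RichInf w) where

  private
    Power : Set
    Power = ContainsPower a b w

  open Languages Power

  Factor : Word → Set
  Factor u = ∃[ i ] Occurs w i u

  power : ∀ i p y → 0 < p → Occurs w i y → Occurs w (i + p) y → a * p ≤ (p + length y) * b → Power
  power i p y p>0 o o′ le = i , p + length y , p , ≤-trans p>0 (m≤m+n p _) , p>0 ,
    (λ k lt → trans (occurs-lookup w i (i + p) y o o′ k (+-cancelˡ-< p k (length y) (≤-trans (≤-reflexive (cong suc (+-comm p k))) lt)))
                    (cong w (lem i p k))) ,
    le
    where
    lem : ∀ i p k → i + p + k ≡ i + k + p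
    lem = solve-∀

  elevenFourths-power : ∀ ps u → Binary.hasPower elevenFourths ps u ≡ true → Factor u → Power
  elevenFourths-power ps u e (i , o) with Binary.hasPower-sound elevenFourths ps u e
  ... | l , s , p , y , r , r′ , refl , len , refl , e′ =
    power (i + length l) (suc p) y (s≤s z≤n) (occurs-++⁻ˡ w _ y (occurs-++⁻ʳ w i l o))
      (occurs-++⁻ˡ w _ y (subst (Occurs w (i + length l + suc p)) e′ (occurs-drop w (i + length l) (suc p) (y ++ r) (occurs-++⁻ʳ w i l o))))
      (subst (λ m → a * suc p ≤ (suc p + m) * b) (sym len) (elevenFourths-exceeds a b b>0 b<a small (suc p)))

  factor-rich : ∀ u → Factor u → RichFinite u
  factor-rich u (i , o) = subst RichFinite (trans (factorAt-letters w i (length u)) (occurs-letters w i u o)) (rich i (length u))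

  factors-language : Language Factor
  factors-language = record
    { factor-closed  = λ { {u} (l , r , refl) (i , o) → i + length l , occurs-++⁻ˡ w _ u (occurs-++⁻ʳ w i l o) }
    ; allNew         = λ u f → rich⇒allNew u (factor-rich u f)
    ; allNew-reverse = λ u f → rich⇒allNew (reverse u) (rich-reverse u (factor-rich u f))
    ; cube           = λ v ne (i , o) → cube-power v ne i o
    }
    where
    cube-power : ∀ v → v ≢ [] → ∀ i → Occurs w i (v ++ v ++ v) → Power
    cube-power []      ne i o = ⊥-elim (ne refl)
    cube-power (c ∷ v) ne i o = power i (length (c ∷ v)) ((c ∷ v) ++ (c ∷ v)) (s≤s z≤n)
      (occurs-++⁻ˡ w i ((c ∷ v) ++ (c ∷ v)) (subst (Occurs w i) (sym (++-assoc (c ∷ v) (c ∷ v) (c ∷ v))) o))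
      (occurs-++⁻ʳ w i (c ∷ v) o)
      (≤-trans (elevenFourths-exceeds a b b>0 b<a small p) (*-monoˡ-≤ b (+-monoʳ-≤ p (≤-trans (m∸n≤m (2 * p) (p / 4))
        (≤-reflexive (trans (cong (p +_) (+-identityʳ p)) (sym (length-++ (c ∷ v)))))))))
      where p = length (c ∷ v)

  -- Desubstitution shortens words, so the levels are chained from the deepest outwards: a length
  -- that forces a power at one level yields such a length for the level above.
  Avoided : (∀ {A : Set} → (List A → Set) → Set)
  Avoided P = ∃[ N ] ∀ u → N ≤ length u → P u → Power

  module _ {P : Ternary → Set} (L : Language P) where
    open Language L

    defective-power : ∀ k u → Tern.defective k u ≡ true → P u → Power
    defective-power k u e p = ⊥-elim (Tern.defective-sound k u (allNew u p) (allNew-reverse u p) e)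

    cubes-power : ∀ ps u → Tern.hasPower twice ps u ≡ true → P u → Power
    cubes-power ps u e p with Tern.hasPower-sound twice ps u e
    ... | l , s , n , y , r , r′ , refl , len , e₁ , e₂ with cube-prefix n s y len e₁ e₂
    ...   | v , ne , inf = cube v ne (factor-closed (infix-++ˡ l inf) p)

  ĥ-language : ∀ {P} → Language P → Language (P ∘ ĥ)
  ĥ-language = preimage h-coding

  underĥ-language : ∀ k {P} → Language P → Language (underĥ k P)
  underĥ-language zero    L = L
  underĥ-language (suc k) L = underĥ-language k (ĥ-language L)

  -- Once 111 is excluded, the letters 0 cut a word into the blocks 0, 01 and 011, so testing period
  -- 1 is enough.
  avoided-f : Avoided (Factor ∘ f̂) → Avoided Factor
  avoided-f (n , avoid) = proj₁ parsed , λ u le p → result (proj₂ parsed u le p)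
    where
    parsed = Parse₀.desubstitute booleans-complete ⊤-complete 3
      (λ { _ 0F → s≤s z≤n ; _ 1F → s≤s (s≤s z≤n) ; _ 2F → ≤-refl })
      (Language.factor-closed factors-language) (elevenFourths-power (1 ∷ [])) checked₀ n
    result : Power ⊎ (∃[ i ] ∃[ v ] (length v ≡ n × Factor (f̂ v))) → Power
    result (inj₁ g)                 = g
    result (inj₂ (_ , v , len , p)) = avoid v (≤-reflexive (sym len)) p

  h-bound : ∀ (i : ⊤) c → length (0F ∷ h-code c) ≤ 3
  h-bound _ 0F = s≤s (s≤s z≤n)
  h-bound _ 1F = s≤s (s≤s z≤n)
  h-bound _ 2F = ≤-refl

  avoided-image : ∀ φ ps → Language (Factor ∘ φ) → ParseImage.Verified φ ps →
    Avoided (Factor ∘ φ ∘ ĥ) → Avoided (Factor ∘ φ)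
  avoided-image φ ps L checked (n , avoid) = proj₁ parsed , λ u le p → result (proj₂ parsed u le p)
    where
    bad-sound : ∀ u → badImage φ ps u ≡ true → Factor (φ u) → Power
    bad-sound u e p with ∨-true (Binary.hasPower elevenFourths ps (φ u)) e
    ... | inj₁ e′ = elevenFourths-power ps (φ u) e′ p
    ... | inj₂ e′ = defective-power L 2 u e′ p
    parsed = ParseImage.desubstitute φ ps letters₃-complete ⊤-complete 3 h-bound
      (Language.factor-closed L) bad-sound checked n
    result : Power ⊎ (∃[ i ] ∃[ v ] (length v ≡ n × Factor (φ (ĥ v)))) → Power
    result (inj₁ g)                 = g
    result (inj₂ (_ , v , len , p)) = avoid v (≤-reflexive (sym len)) p

  -- `P` is arbitrary: the search sees only three applications of h and the cubes of the language,
  -- so this step can be iterated as often as required.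
  avoided-deep : ∀ {P} → Language P → Avoided (P ∘ ĥ ∘ ĥ ∘ ĥ ∘ ĥ) → Avoided (P ∘ ĥ ∘ ĥ ∘ ĥ)
  avoided-deep {P} L (n , avoid) = proj₁ parsed , λ u le p → result (proj₂ parsed u le p)
    where
    bad-sound : ∀ u → badDeep u ≡ true → P (ĥ (ĥ (ĥ u))) → Power
    bad-sound u e p with ∨-true (Tern.hasPower twice periods-hhh (ĥ (ĥ (ĥ u)))) e
    ... | inj₁ e′ = cubes-power L periods-hhh (ĥ (ĥ (ĥ u))) e′ p
    ... | inj₂ e′ = defective-power (underĥ-language 3 L) 2 u e′ p
    parsed = ParseDeep.desubstitute letters₃-complete ⊤-complete 3 h-bound
      (Language.factor-closed (underĥ-language 3 L)) bad-sound checked-deep n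
    result : Power ⊎ (∃[ i ] ∃[ v ] (length v ≡ n × P (ĥ (ĥ (ĥ (ĥ v)))))) → Power
    result (inj₁ g)                 = g
    result (inj₂ (_ , v , len , p)) = avoid v (≤-reflexive (sym len)) p

  avoided-gh : Avoided (Factor ∘ f̂ ∘ ĝ) → Avoided (Factor ∘ f̂ ∘ ĥ) → Avoided (Factor ∘ f̂)
  avoided-gh (n , avoid) (n′ , avoid′) = proj₁ parsed , λ u le p → result (proj₂ parsed u le p)
    where
    L : Language (Factor ∘ f̂)
    L = preimage f-coding factors-language
    bound : ∀ i c → length (0F ∷ gh-code i c) ≤ 6
    bound false 0F = s≤s (s≤s (s≤s z≤n))
    bound false 1F = s≤s (s≤s (s≤s (s≤s z≤n)))
    bound false 2F = ≤-refl
    bound true  c  = ≤-trans (h-bound tt c) (s≤s (s≤s (s≤s z≤n)))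
    bad-sound : ∀ u → bad₁ u ≡ true → Factor (f̂ u) → Power
    bad-sound u e p with ∨-true (Binary.hasPower elevenFourths periods-f (f̂ u)) e
    ... | inj₁ e′ = elevenFourths-power periods-f (f̂ u) e′ p
    ... | inj₂ e′ = ⊥-elim (Binary.defective-sound 4 (f̂ u) (Language.allNew factors-language (f̂ u) p)
                              (Language.allNew-reverse factors-language (f̂ u) p) e′)
    -- Which of the two codings occurs is known only after the search, so a length sufficient for
    -- both is requested.
    parsed = Parse₁.desubstitute letters₃-complete booleans-complete 6 bound
      (Language.factor-closed L) bad-sound checked₁ (n + n′)
    result : Power ⊎ (∃[ i ] ∃[ v ] (length v ≡ n + n′ × Factor (f̂ (Substitution.σ̂ (λ c → 0F ∷ gh-code i c) 0F v)))) → Power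
    result (inj₁ g)                     = g
    result (inj₂ (false , v , len , p)) = avoid v (≤-trans (m≤m+n n n′) (≤-reflexive (sym len))) p
    result (inj₂ (true  , v , len , p)) = avoid′ v (≤-trans (m≤n+m n′ n) (≤-reflexive (sym len))) p

  avoided-underĥ : ∀ k {P} → Language P → Avoided (underĥ k P ∘ ĥ ∘ ĥ ∘ ĥ) → Avoided (P ∘ ĥ ∘ ĥ ∘ ĥ)
  avoided-underĥ zero    L avoid = avoid
  avoided-underĥ (suc k) L avoid = avoided-deep L (avoided-underĥ k (ĥ-language L) avoid)

  flanked-lifts : ∀ j {P} → Language P → underĥ (double j) P (flanked (whole (lifts 0))) → P (flanked (whole (lifts j)))
  flanked-lifts zero    L p = p
  flanked-lifts (suc j) L p =
    Language.factor-closed L (flanked-lift (lifts j)) (flanked-lifts j (ĥ-language (ĥ-language L)) p)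

  -- Three applications of `ĥ` to a single letter already produce 0220, whatever the letter; hence
  -- the length 1.
  avoided-seed : ∀ {Q} → Language Q → (Q (flanked (whole (lifts 0))) → Power) → Avoided (Q ∘ ĥ ∘ ĥ ∘ ĥ)
  avoided-seed {Q} L avoid = 1 , λ { (c ∷ u) _ q →
    avoid (Language.factor-closed L (seed c) (Language.factor-closed (underĥ-language 3 L) {c ∷ []} {c ∷ u} ([] , u , refl) q)) }
    where
    seed : ∀ c → Infix (flanked (whole (lifts 0))) (ĥ (ĥ (ĥ (c ∷ []))))
    seed 0F = Tern.isInfix-sound _ _ refl
    seed 1F = Tern.isInfix-sound _ _ refl
    seed 2F = Tern.isInfix-sound _ _ refl

  -- Here p, q and p + q are the lengths of the images of 0, 1 and 2 under φ, and D = q² − 2 p².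
  module _ (φ : Ternary → Word) (φ-++ : ∀ u v → φ (u ++ v) ≡ φ u ++ φ v) (p q D : ℕ)
           (φ-length : ∀ u → length (φ u) ≡ weight₃ p q u) (p>0 : 0 < p) (norm : q * q ≡ 2 * (p * p) + D) (q≤2p : q ≤ 2 * p) where

    private
      C level P Q : ℕ
      -- `C` is the defect in `border-weight`, and `level` is the threshold of `limit-reached`. Each
      -- application of h² raises the first weight by at least 1, so `level` of them exceed it as p
      -- > 0.
      C = 2 * p + q
      level = b * b * (D + 4 * C + C * C) + C
      P = proj₁ (scaled level p q)
      Q = proj₂ (scaled level p q)
      s o : Ternary
      s = lead (lifts level)
      o = border (lifts level)

      period : length (φ (s ++ 2F ∷ [])) ≡ P + Q
      period = trans (φ-length (s ++ 2F ∷ [])) (trans (weight₃-++ p q s (2F ∷ []))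
        (trans (cong (weight₃ p q s +_) (+-identityʳ (p + q))) (period-weight level p q)))

      exponent : a * (P + Q) ≤ (P + Q + length (φ o)) * b
      exponent = *-cancelˡ-≤ 2 (+-cancelʳ-≤ (b * C) _ _ (begin
        2 * (a * (P + Q)) + b * C                       ≡⟨ cong (_+ b * C) (*-assoc 2 a (P + Q)) ⟨
        2 * a * (P + Q) + b * C                         ≤⟨ limit-reached a b b>0 b<a small P Q C D (proj₁ (scaled-norm level p q D norm q≤2p))
                                                             (proj₂ (scaled-norm level p q D norm q≤2p))
                                                             (≤-trans (+-monoˡ-≤ level p>0) (scaled-grows level p q p>0)) ⟩
        b * (6 * P + 5 * Q)                             ≡⟨ lem₁ b P Q ⟩
        2 * b * (P + Q) + b * (4 * P + 3 * Q)           ≡⟨ cong (λ x → 2 * b * (P + Q) + b * x) (border-weight level p q) ⟨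
        2 * b * (P + Q) + b * (2 * weight₃ p q o + C)   ≡⟨ cong (λ x → 2 * b * (P + Q) + b * (2 * x + C)) (φ-length o) ⟨
        2 * b * (P + Q) + b * (2 * length (φ o) + C)    ≡⟨ lem₂ b (P + Q) (length (φ o)) C ⟩
        2 * ((P + Q + length (φ o)) * b) + b * C        ∎))
        where
        open ≤-Reasoning
        lem₁ : ∀ b P Q → b * (6 * P + 5 * Q) ≡ 2 * b * (P + Q) + b * (4 * P + 3 * Q)
        lem₁ = solve-∀
        lem₂ : ∀ b P l C → 2 * b * P + b * (2 * l + C) ≡ 2 * ((P + l) * b) + b * C
        lem₂ = solve-∀

    repetition-power : Factor (φ (whole (lifts level))) → Power
    repetition-power (i , occ) = power i (length (φ (s ++ 2F ∷ []))) (φ o) positive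
      (occurs-++⁻ˡ w i (φ o) (subst (Occurs w i) (trans (cong φ (bordered (lifts level))) (φ-++ o _)) occ))
      (occurs-++⁻ʳ w i (φ (s ++ 2F ∷ [])) (subst (Occurs w i) (trans (cong φ (sym (++-assoc s (2F ∷ []) o))) (φ-++ (s ++ 2F ∷ []) o)) occ))
      (subst (λ m → a * m ≤ (m + length (φ o)) * b) (sym period) exponent)
      where
      positive : 0 < length (φ (s ++ 2F ∷ []))
      positive = subst (0 <_) (sym period) (≤-trans p>0 (≤-trans (≤-trans (m≤m+n p level) (scaled-grows level p q p>0)) (m≤m+n P Q)))

    avoided-repetitions : ∀ {R} → Language R → (∀ {u} → R u → Factor (φ u)) → Avoided (R ∘ ĥ ∘ ĥ ∘ ĥ)
    avoided-repetitions L R⊆ = avoided-underĥ (double level) L (avoided-seed (underĥ-language (double level) L) (λ r →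
      repetition-power (R⊆ (Language.factor-closed L (0F ∷ [] , 0F ∷ [] , refl) (flanked-lifts level L r)))))

  f-language : Language (Factor ∘ f̂)
  f-language = preimage f-coding factors-language

  fg-language : Language (Factor ∘ f̂ ∘ ĝ)
  fg-language = preimage g-coding f-language

  fh-avoided : Avoided (Factor ∘ f̂ ∘ ĥ)
  fh-avoided =
    avoided-image (f̂ ∘ ĥ) periods-fh (ĥ-language f-language) checked-fh
      (avoided-image (f̂ ∘ ĥ ∘ ĥ) periods-fhh (ĥ-language (ĥ-language f-language)) checked-fhh
        (avoided-repetitions f (Coding.σ-++ f-coding) 1 2 2 length-f (s≤s z≤n) refl ≤-refl f-language
          (λ {u} → Language.factor-closed factors-language ([] , false ∷ [] , refl))))

  -- `avoided-repetitions` starts three applications of h below its language. In the branch of h one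
  -- of them is already present; here all three have to be peeled off by separate searches.
  fg-avoided : Avoided (Factor ∘ f̂ ∘ ĝ)
  fg-avoided =
    avoided-image (f̂ ∘ ĝ) periods-fg fg-language checked-fg
      (avoided-image (f̂ ∘ ĝ ∘ ĥ) periods-fgh (ĥ-language fg-language) checked-fgh
        (avoided-image (f̂ ∘ ĝ ∘ ĥ ∘ ĥ) periods-fghh (ĥ-language (ĥ-language fg-language)) checked-fghh
          (avoided-repetitions (f ∘ g) (λ u v → trans (cong f (Coding.σ-++ g-coding u v)) (Coding.σ-++ f-coding (g u) (g v)))
            5 8 14 length-fg (s≤s z≤n) refl (m≤m+n 8 2) fg-language
            (λ {u} → Language.factor-closed factors-language ([] , false ∷ false ∷ [] ,
              trans (cong (_∷ʳ false) (Coding.σ-++ f-coding (g u) (0F ∷ []))) (++-assoc (f (g u)) (false ∷ []) (false ∷ [])))))))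

  occurs-self : ∀ i n → Occurs w i (letters w i n)
  occurs-self i zero    = tt
  occurs-self i (suc n) = refl , occurs-self (suc i) n

  length-letters : ∀ i n → length (letters w i n) ≡ n
  length-letters i zero    = refl
  length-letters i (suc n) = cong suc (length-letters (suc i) n)

  contains-power : ContainsPower a b w
  contains-power = avoid (letters w 0 N) (≤-reflexive (sym (length-letters 0 N))) (0 , occurs-self 0 N)
    where
    avoided = avoided-f (avoided-gh fg-avoided fh-avoided)
    N = proj₁ avoided
    avoid = proj₂ avoided

theorem2 : ((a b : ℕ) → 0 < b → 2 * (b * b) < (2 * a ∸ 4 * b) ^ 2 →
    ∃[ w ] (RichInf w × Free a b w))
    ×
    ((a b : ℕ) → 0 < b → b < a → (2 * a ∸ 4 * b) ^ 2 < 2 * (b * b) →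
    (w : InfWord) → RichInf w → ContainsPower a b w)
theorem2 =
  (λ a b b>0 large → roteWord , roteWord-rich , roteWord-free a b b>0 large) ,
  contains-power
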